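{- Let $G$ be a diamond-free graph of order $n$. Then $G$ is minimally unbalanced if and only if $n\ge 5$ is odd and either $A_G\cong C_n$ or $A_G\cong \begin{bmatrix} C_n\\ K\end{bmatrix}$ for some matrix $K$ all of whose rows have at least three nonzero entries and such that, for every row submatrix $K'$ of $K$ and every odd $t<n$, no column submatrix of $\begin{bmatrix} C_n\\ K'\end{bmatrix}$ has an up-matrix congruent to $C_t$.
   Context: The clique-matrix $A_G$ of a graph $G$ is the $\{0,1\}$-matrix with columns indexed by $V(G)$ and rows the incidence vectors of the maximal cliques of $G$. A $\{0,1\}$-matrix is balanced if it has no square submatrix of odd order with exactly two 1's per row and per column; $G$ is balanced if $A_G$ is; $G$ is minimally unbalanced if it is not balanced but every proper induced subgraph is balanced. The diamond is $K_4$ minus an edge; diamond-free means no induced diamond. Two $\{0,1\}$-matrices are congruent ($\cong$) if one is obtained from the other by permuting rows and columns. $C_n=(c_{ij})$ is the $n\times n$ matrix with $c_{ij}=1$ iff $j\in\{i,i+1\}$ (indices mod $n$). $\begin{bmatrix} X\\ Y\end{bmatrix}$ denotes $X$ stacked above $Y$. A row $r$ of a matrix is dominated if $r\le r'$ componentwise for some other row $r'$; the up-matrix of a matrix is its row submatrix formed by the non-dominated rows. A row (column) submatrix consists of some of the rows (columns). -}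

module Defs where

open import Data.Bool using (Bool; true; false; _∧_; _∨_; not; if_then_else_)
open import Data.Nat using (ℕ; zero; suc; _+_; _*_; _∸_; _≡ᵇ_; _<_)
open import Data.Fin using (Fin; toℕ; splitAt)
import Data.Fin as F
open import Data.Vec using (Vec; []; _∷_; lookup; updateAt)
open import Data.List using (List; []; _∷_; _++_; map; filterᵇ; length; allFin)
open import Data.Bool.ListAction using (all; any)
import Data.List as L
open import Data.Sum using (_⊎_; inj₁; inj₂; [_,_])
open import Data.Product using (Σ; _×_; _,_; ∃)
open import Function.Bundles using (_↔_; Inverse)
open import Function.Definitions using (Injective)
open import Relation.Binary.PropositionalEquality using (_≡_)
open import Relation.Nullary using (¬_)

Odd : ℕ → Set
Odd n = ∃ λ k → n ≡ suc (2 * k)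

count : {t : ℕ} → (Fin t → Bool) → ℕ
count {zero}  f = 0
count {suc t} f = (if f F.zero then 1 else 0) + count (λ i → f (F.suc i))

_==_ : {n : ℕ} → Fin n → Fin n → Bool
i == j = toℕ i ≡ᵇ toℕ j

Mat : ℕ → ℕ → Set
Mat m k = Fin m → Fin k → Bool

_≅_ : {m k m' k' : ℕ} → Mat m k → Mat m' k' → Set
_≅_ {m} {k} {m'} {k'} M N =
  Σ (Fin m ↔ Fin m') λ σ → Σ (Fin k ↔ Fin k') λ τ →
    ∀ i j → M i j ≡ N (Inverse.to σ i) (Inverse.to τ j)

-- C_t : c_ij = 1 iff j ∈ {i, i+1} (indices mod t), 0-based here
C : (t : ℕ) → Mat t t
C t i j = (toℕ j ≡ᵇ toℕ i) ∨ (toℕ j ≡ᵇ suc (toℕ i))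
          ∨ ((toℕ i ≡ᵇ t ∸ 1) ∧ (toℕ j ≡ᵇ 0))

stack : {m p k : ℕ} → Mat m k → Mat p k → Mat (m + p) k
stack {m} X Y i j = [ (λ a → X a j) , (λ b → Y b j) ] (splitAt m i)

rowSub : {m k p : ℕ} → Mat m k → (Fin p → Fin m) → Mat p k
rowSub M ρ i j = M (ρ i) j

colSub : {m k s : ℕ} → Mat m k → (Fin s → Fin k) → Mat m s
colSub M γ i j = M i (γ j)

dominated : {m k : ℕ} → Mat m k → Fin m → Bool
dominated {m} {k} M i =
  any (λ i' → not (i' == i) ∧ all (λ j → not (M i j) ∨ M i' j) (allFin k)) (allFin m)

upRows : {m k : ℕ} → Mat m k → List (Fin m)
upRows {m} M = filterᵇ (λ i → not (dominated M i)) (allFin m)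

upMatrix : {m k : ℕ} → (M : Mat m k) → Mat (length (upRows M)) k
upMatrix M i j = M (L.lookup (upRows M) i) j

Balanced : {m k : ℕ} → Mat m k → Set
Balanced {m} {k} M =
  ∀ (t : ℕ) → Odd t →
  (r : Fin t → Fin m) → Injective _≡_ _≡_ r →
  (c : Fin t → Fin k) → Injective _≡_ _≡_ c →
  ¬ ((∀ i → count (λ j → M (r i) (c j)) ≡ 2) ×
     (∀ j → count (λ i → M (r i) (c j)) ≡ 2))

record Graph (n : ℕ) : Set where
  field
    adj    : Fin n → Fin n → Bool
    sym    : ∀ i j → adj i j ≡ adj j i
    irrefl : ∀ i → adj i i ≡ false
open Graph public

allSubsets : (n : ℕ) → List (Vec Bool n)
allSubsets zero    = [] ∷ []
allSubsets (suc n) = map (true ∷_) (allSubsets n) ++ map (false ∷_) (allSubsets n)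

isClique : {n : ℕ} → Graph n → Vec Bool n → Bool
isClique {n} G S =
  all (λ i → all (λ j → not (lookup S i ∧ lookup S j) ∨ (i == j) ∨ adj G i j)
                 (allFin n)) (allFin n)

-- maximal clique: a clique not extendable by any outside vertex
-- (equivalently: not properly contained in any clique)
isMaximalClique : {n : ℕ} → Graph n → Vec Bool n → Bool
isMaximalClique {n} G S =
  isClique G S ∧
  all (λ v → lookup S v ∨ not (isClique G (updateAt S v (λ _ → true)))) (allFin n)

maximalCliques : {n : ℕ} → Graph n → List (Vec Bool n)
maximalCliques {n} G = filterᵇ (isMaximalClique G) (allSubsets n)

cliqueMatrix : {n : ℕ} → (G : Graph n) → Mat (length (maximalCliques G)) n
cliqueMatrix G i j = lookup (L.lookup (maximalCliques G) i) j

BalancedGraph : {n : ℕ} → Graph n → Set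
BalancedGraph G = Balanced (cliqueMatrix G)

induced : {n k : ℕ} → Graph n → (Fin k → Fin n) → Graph k
induced G f = record
  { adj    = λ i j → adj G (f i) (f j)
  ; sym    = λ i j → sym G (f i) (f j)
  ; irrefl = λ i → irrefl G (f i) }

MinimallyUnbalanced : {n : ℕ} → Graph n → Set
MinimallyUnbalanced {n} G =
  ¬ BalancedGraph G ×
  (∀ (k : ℕ) (f : Fin k → Fin n) → Injective _≡_ _≡_ f → k < n →
     BalancedGraph (induced G f))

DiamondFree : {n : ℕ} → Graph n → Set
DiamondFree {n} G =
  ∀ (a b c d : Fin n) →
  ¬ a ≡ b → ¬ a ≡ c → ¬ a ≡ d → ¬ b ≡ c → ¬ b ≡ d → ¬ c ≡ d →
  ¬ (adj G a b ≡ true × adj G a c ≡ true × adj G a d ≡ true ×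
     adj G b c ≡ true × adj G b d ≡ true × adj G c d ≡ false)

GoodK : {n p : ℕ} → Mat p n → Set
GoodK {n} {p} K =
  (∀ r → 3 ≤ count (K r)) ×
  (∀ (p' : ℕ) (ρ : Fin p' → Fin p) → Injective _≡_ _≡_ ρ →
   ∀ (t : ℕ) → Odd t → t < n →
   ∀ (s : ℕ) (γ : Fin s → Fin n) → Injective _≡_ _≡_ γ →
   ¬ (upMatrix (colSub (stack (C n) (rowSub K ρ)) γ) ≅ C t))
  where open import Data.Nat using (_≤_)

{-# OPTIONS --safe #-}
module Submission where

-- In a diamond-free graph every edge lies in exactly one maximal clique, so two rows of the clique matrix
-- share at most one column, and an odd square submatrix with two 1's per row and column ("two-regular")
-- survives in the subgraph induced on its columns and in every larger graph. Hence G is minimally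
-- unbalanced iff an odd two-regular submatrix exists and all of them use every vertex.
-- A smallest odd two-regular submatrix of size t is a single cycle C t: otherwise a cycle of its 2-regular
-- graph or the complement of that cycle is a smaller one of odd order. No further row meets its columns
-- in exactly two places, for that chord would cut off a shorter odd cycle.
-- With t = n this gives the shape C n over K. Conversely, a smallest odd two-regular submatrix of C n over K
-- with t < n is the up-matrix excluded for K, since the rows off it meet its columns at most once.

open import Defs
open import Data.Nat using (ℕ; _≤_)
open import Data.Product using (Σ; _×_)
open import Data.Sum using (_⊎_)
open import Function.Bundles using (_⇔_)

open import Data.Bool using (Bool; true; false; _∧_; _∨_; not; T?)
import Data.Bool as Bool
open import Data.Bool.ListAction using (all; any)
open import Data.Bool.Properties using (T-≡)
open import Data.Empty using (⊥; ⊥-elim)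
open import Data.Fin using (Fin; toℕ; fromℕ<; splitAt; punchIn; punchOut; _↑ˡ_; _↑ʳ_)
import Data.Fin as Fin
import Data.Fin.Properties as Fin
open import Data.List using (List; []; _∷_; _++_; map; allFin; length)
import Data.List as List
open import Data.List.Membership.Propositional using (_∈_)
open import Data.List.Membership.Propositional.Properties
  using (∈-allFin; ∈-lookup; ∈-map⁺; ∈-map⁻; ∈-++⁺ˡ; ∈-++⁺ʳ; ∈-filter⁺; ∈-filter⁻)
open import Data.List.Relation.Unary.Any using (here; there; index)
open import Data.List.Relation.Unary.Any.Properties using (lookup-index)
open import Data.List.Relation.Unary.AllPairs using ([]; _∷_)
import Data.List.Relation.Unary.All as All
open All using ([])
open import Data.List.Relation.Unary.Unique.Propositional using (Unique)
import Data.List.Relation.Unary.Unique.Propositional.Properties as Unique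
open import Data.Nat using (zero; suc; _+_; _*_; _∸_; _<_; _<?_; _≡ᵇ_; z≤n; s≤s)
import Data.Nat as ℕ
import Data.Nat.Properties as ℕ
open import Data.Nat.Induction using (<-rec)
open import Data.Product using (∃; _,_; proj₁; proj₂; -,_)
open import Data.Sum using (inj₁; inj₂; [_,_]′; swap)
import Data.Sum as Sum
open import Data.Sum.Properties using (inj₂-injective)
open import Data.Vec using (Vec; lookup; tabulate; updateAt)
import Data.Vec as Vec
import Data.Vec.Properties as Vec
open import Function using (_∘_; id; case_of_)
open import Function.Bundles using (_↔_; Inverse; Equivalence; mk⇔; mk↔ₛ′)
open import Function.Definitions using (Injective)
open import Relation.Binary.PropositionalEquality
  using (_≡_; _≢_; refl; trans; cong; cong₂; subst; subst₂; module ≡-Reasoning) renaming (sym to ≡-sym)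
open import Relation.Binary.Definitions using (tri<; tri≈; tri>)
open import Relation.Nullary using (¬_; Dec; yes; no; contradiction)
open import Relation.Nullary.Decidable using (_×-dec_; _→-dec_; map′; ¬?)

-- An edge of a diamond-free graph has pairwise adjacent common neighbours; together with its two
-- ends they form the one maximal clique through it. The threshold three for the rows of `K` comes
-- from parity. Two columns cut an odd cycle into arcs of odd total length, so exactly one arc is
-- even, and that arc closes up to an odd cycle. Three columns can leave three odd arcs, and then
-- nothing shorter arises. Small orders need separate care. An odd two-regular submatrix has order
-- at least 3, and n = 3 fails because a triangle lies in a single clique; this is the origin of the
-- bound 5. `C 1` is not two-regular, so it has to be excluded as an up-matrix by domination alone.
-- Being unbalanced is a negated universal statement, so the submatrix from which the construction
-- starts has to be found by a finite search.

-- Reflection of Boolean tests.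

bool-ext : ∀ {p q : Bool} → (p ≡ true → q ≡ true) → (q ≡ true → p ≡ true) → p ≡ q
bool-ext {true}  {true}  _ _ = refl
bool-ext {true}  {false} f _ = contradiction (f refl) λ ()
bool-ext {false} {true}  _ g = contradiction (g refl) λ ()
bool-ext {false} {false} _ _ = refl

∧-true⁻ : ∀ {p q} → p ∧ q ≡ true → p ≡ true × q ≡ true
∧-true⁻ {true} {true} _ = refl , refl

∧-true⁺ : ∀ {p q} → p ≡ true → q ≡ true → p ∧ q ≡ true
∧-true⁺ refl refl = refl

∨-true⁻ : ∀ {p q} → p ∨ q ≡ true → p ≡ true ⊎ q ≡ true
∨-true⁻ {true}  _ = inj₁ refl
∨-true⁻ {false} e = inj₂ e

∨-true⁺ : ∀ {p q} → p ≡ true ⊎ q ≡ true → p ∨ q ≡ true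
∨-true⁺ {true}  _        = refl
∨-true⁺ {false} (inj₂ e) = e

implies-true⁺ : ∀ {p q} → (p ≡ true → q ≡ true) → not p ∨ q ≡ true
implies-true⁺ {true}  f = f refl
implies-true⁺ {false} _ = refl

implies-true⁻ : ∀ {p q} → not p ∨ q ≡ true → p ≡ true → q ≡ true
implies-true⁻ e refl = e

all⁻ : ∀ {A : Set} (p : A → Bool) {xs x} → all p xs ≡ true → x ∈ xs → p x ≡ true
all⁻ p {y ∷ ys} e (here refl) = proj₁ (∧-true⁻ e)
all⁻ p {y ∷ ys} e (there x∈)  = all⁻ p (proj₂ (∧-true⁻ {p y} e)) x∈

all⁺ : ∀ {A : Set} (p : A → Bool) xs → (∀ x → p x ≡ true) → all p xs ≡ true
all⁺ p []       _ = refl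
all⁺ p (x ∷ xs) f = ∧-true⁺ (f x) (all⁺ p xs f)

any⁻ : ∀ {A : Set} (p : A → Bool) xs → any p xs ≡ true → ∃ λ x → p x ≡ true
any⁻ p (x ∷ xs) e = [ x ,_ , any⁻ p xs ]′ (∨-true⁻ e)

any⁺ : ∀ {A : Set} (p : A → Bool) {xs x} → x ∈ xs → p x ≡ true → any p xs ≡ true
any⁺ p (here refl) e = ∨-true⁺ (inj₁ e)
any⁺ p {y ∷ ys} (there x∈) e = ∨-true⁺ {p y} (inj₂ (any⁺ p x∈ e))

≡ᵇ⁻ : ∀ {a b} → (a ≡ᵇ b) ≡ true → a ≡ b
≡ᵇ⁻ e = ℕ.≡ᵇ⇒≡ _ _ (Equivalence.from T-≡ e)

≡ᵇ⁺ : ∀ {a b} → a ≡ b → (a ≡ᵇ b) ≡ true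
≡ᵇ⁺ e = Equivalence.to T-≡ (ℕ.≡⇒≡ᵇ _ _ e)

==⁻ : ∀ {n} {i j : Fin n} → (i == j) ≡ true → i ≡ j
==⁻ e = Fin.toℕ-injective (≡ᵇ⁻ e)

==⁺ : ∀ {n} {i j : Fin n} → i ≡ j → (i == j) ≡ true
==⁺ e = ≡ᵇ⁺ (cong toℕ e)

-- Parity, least witnesses, and complements of finite injections.

parity : ∀ n → Odd n ⊎ ∃ λ k → n ≡ 2 * k
parity zero    = inj₂ (0 , refl)
parity (suc n) with parity n
... | inj₁ (k , refl) = inj₂ (suc k , cong suc (≡-sym (ℕ.+-suc k (k + 0))))
... | inj₂ (k , refl) = inj₁ (k , refl)

odd-summand : ∀ {s l} → (∃ λ k → l ≡ 2 * k) → Odd (s + l) → Odd s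
odd-summand {s} (k , refl) (h , e) with parity s
... | inj₁ o          = o
... | inj₂ (g , refl) =
  contradiction (trans (ℕ.*-distribˡ-+ 2 g k) e) (ℕ.even≢odd (g + k) h)

odd+odd≢odd : ∀ {a b} → Odd a → Odd b → ¬ Odd (a + b)
odd+odd≢odd {a} {b} (k , refl) (l , refl) (h , e) = ℕ.even≢odd (suc (k + l)) h (trans lem e)
  where
  open ≡-Reasoning
  lem : 2 * suc (k + l) ≡ suc (2 * k) + suc (2 * l)
  lem = begin
    2 * suc (k + l)           ≡⟨ ℕ.*-suc 2 (k + l) ⟩
    2 + 2 * (k + l)           ≡⟨ cong (2 +_) (ℕ.*-distribˡ-+ 2 k l) ⟩
    2 + (2 * k + 2 * l)       ≡⟨ cong suc (≡-sym (ℕ.+-suc (2 * k) (2 * l))) ⟩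
    suc (2 * k) + suc (2 * l) ∎

least : ∀ {P : ℕ → Set} → (∀ n → Dec (P n)) → ∀ n → P n →
        ∃ λ m → P m × m ≤ n × (∀ l → l < m → ¬ P l)
least {P} P? = <-rec (λ n → P n → ∃ λ m → P m × m ≤ n × (∀ l → l < m → ¬ P l)) go
  where
  go : ∀ n → (∀ {l} → l < n → P l → ∃ λ m → P m × m ≤ l × (∀ l′ → l′ < m → ¬ P l′)) →
       P n → ∃ λ m → P m × m ≤ n × (∀ l → l < m → ¬ P l)
  go n rec pn with ℕ.anyUpTo? P? n
  ... | yes (l , l<n , pl) with rec l<n pl
  ...   | m , pm , m≤l , min = m , pm , ℕ.≤-trans m≤l (ℕ.<⇒≤ l<n) , min
  go n rec pn | no none = n , pn , ℕ.≤-refl , λ l l<n pl → none (l , l<n , pl)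

-- Induction on `l`: the value at zero is missed by the remaining values, so it lies in their
-- complement and is punched out there. The equation `s + l ≡ t` is recorded because it forces the
-- complements of equally many rows and columns to have equal size.
complement : ∀ {l t} (g : Fin l → Fin t) → Injective _≡_ _≡_ g →
             ∃ λ s → s + l ≡ t × Σ (Fin s → Fin t) λ h → Injective _≡_ _≡_ h ×
             (∀ i j → h i ≢ g j) × (∀ x → (∃ λ j → g j ≡ x) ⊎ (∃ λ i → h i ≡ x))
complement {zero}  g _   = -, ℕ.+-identityʳ _ , id , id , (λ _ ()) , λ x → inj₂ (x , refl)
complement {suc l} g inj with complement (g ∘ Fin.suc) (λ e → Fin.suc-injective (inj e))
... | s , eq , h , h-inj , disj , cover with cover (g Fin.zero)
...   | inj₁ (j , e) = contradiction (inj e) λ ()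
complement {suc l} g inj | suc s , eq , h , h-inj , disj , cover | inj₂ (i₀ , e) =
  s , trans (ℕ.+-suc s l) eq , h ∘ punchIn i₀ ,
  (λ p → Fin.punchIn-injective i₀ _ _ (h-inj p)) , disj′ , cover′
  where
  disj′ : ∀ i j → h (punchIn i₀ i) ≢ g j
  disj′ i Fin.zero    p = Fin.punchInᵢ≢i i₀ i (h-inj (trans p (≡-sym e)))
  disj′ i (Fin.suc j) p = disj _ j p
  cover′ : ∀ x → (∃ λ j → g j ≡ x) ⊎ (∃ λ i → h (punchIn i₀ i) ≡ x)
  cover′ x with cover x
  ... | inj₁ (j , p) = inj₁ (Fin.suc j , p)
  ... | inj₂ (i , p) with i₀ Fin.≟ i
  ...   | yes refl = inj₁ (Fin.zero , trans (≡-sym e) p)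
  ...   | no  i₀≢i = inj₂ (punchOut i₀≢i , trans (cong h (Fin.punchIn-punchOut i₀≢i)) p)

injective⇒surjective : ∀ {n} (g : Fin n → Fin n) → Injective _≡_ _≡_ g → ∀ x → ∃ λ i → g i ≡ x
injective⇒surjective {n} g inj x with complement g inj
... | s , eq , h , _ , _ , cover with cover x
...   | inj₁ p       = p
...   | inj₂ (i , _) =
  ⊥-elim (Fin.¬Fin0 (subst Fin (ℕ.+-cancelʳ-≡ n s 0 eq) i))

-- Predicates with exactly two true values.

-- The content of `count f ≡ 2` as data: walking along rows and columns needs the two positions
-- themselves, and these survive restriction to any subset that contains both.
record Two {t} (f : Fin t → Bool) : Set where
  field
    fst snd  : Fin t
    fst≢snd  : fst ≢ snd
    fst-true : f fst ≡ true
    snd-true : f snd ≡ true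
    only     : ∀ x → f x ≡ true → x ≡ fst ⊎ x ≡ snd
open Two

Two-cong : ∀ {t} {f g : Fin t → Bool} → (∀ x → f x ≡ g x) → Two f → Two g
Two-cong f≗g F = record
  { fst = fst F ; snd = snd F ; fst≢snd = fst≢snd F
  ; fst-true = trans (≡-sym (f≗g _)) (fst-true F)
  ; snd-true = trans (≡-sym (f≗g _)) (snd-true F)
  ; only = λ x e → only F x (trans (f≗g x) e) }

Two-swap : ∀ {t} {f : Fin t → Bool} → Two f → Two f
Two-swap F = record
  { fst = snd F ; snd = fst F ; fst≢snd = fst≢snd F ∘ ≡-sym
  ; fst-true = snd-true F ; snd-true = fst-true F ; only = λ x e → swap (only F x e) }

Two-restrict : ∀ {s t} {f : Fin t → Bool} (h : Fin s → Fin t) → Injective _≡_ _≡_ h →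
               (∀ x → f x ≡ true → ∃ λ i → h i ≡ x) → Two f → Two (f ∘ h)
Two-restrict {f = f} h h-inj cover F with cover _ (fst-true F) | cover _ (snd-true F)
... | a , p | b , q = record
  { fst = a ; snd = b
  ; fst≢snd = λ e → fst≢snd F (trans (≡-sym p) (trans (cong h e) q))
  ; fst-true = trans (cong f p) (fst-true F)
  ; snd-true = trans (cong f q) (snd-true F)
  ; only = λ x e → Sum.map (λ r → h-inj (trans r (≡-sym p))) (λ r → h-inj (trans r (≡-sym q)))
                           (only F (h x) e) }

-- Half a step of the later walk: a row entered through one column is left through the other, and
-- likewise for columns.
mate : ∀ {t} {f : Fin t → Bool} {a} → Two f → f a ≡ true →
       ∃ λ b → b ≢ a × f b ≡ true × (∀ x → f x ≡ true → x ≡ a ⊎ x ≡ b)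
mate {a = a} F e with only F a e
... | inj₁ refl = snd F , fst≢snd F ∘ ≡-sym , snd-true F , only F
... | inj₂ refl = fst F , fst≢snd F , fst-true F , λ x p → swap (only F x p)

count-none : ∀ {t} (f : Fin t → Bool) → (∀ i → f i ≢ true) → count f ≡ 0
count-none {zero}  f none = refl
count-none {suc t} f none with f Fin.zero in e
... | true  = contradiction e (none Fin.zero)
... | false = count-none (f ∘ Fin.suc) (none ∘ Fin.suc)

count≡0⇒none : ∀ {t} (f : Fin t → Bool) → count f ≡ 0 → ∀ i → f i ≢ true
count≡0⇒none {suc t} f c i p with f Fin.zero in e
count≡0⇒none {suc t} f () i p | true
count≡0⇒none {suc t} f c Fin.zero p | false = contradiction (trans (≡-sym e) p) λ ()
count≡0⇒none {suc t} f c (Fin.suc i) p | false = count≡0⇒none (f ∘ Fin.suc) c i p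

count-one : ∀ {t} (f : Fin t → Bool) a → f a ≡ true → (∀ x → f x ≡ true → x ≡ a) → count f ≡ 1
count-one {suc t} f Fin.zero p u with f Fin.zero
... | true = cong suc (count-none (f ∘ Fin.suc) λ i q → contradiction (u _ q) λ ())
count-one {suc t} f (Fin.suc a) p u with f Fin.zero in e
... | true  = contradiction (u _ e) λ ()
... | false = count-one (f ∘ Fin.suc) a p λ x q → Fin.suc-injective (u _ q)

count≡1⇒one : ∀ {t} (f : Fin t → Bool) → count f ≡ 1 →
              ∃ λ a → f a ≡ true × (∀ x → f x ≡ true → x ≡ a)
count≡1⇒one {suc t} f c with f Fin.zero in e
... | true  = Fin.zero , e , λ
  { Fin.zero _ → refl
  ; (Fin.suc x) p → contradiction p (count≡0⇒none (f ∘ Fin.suc) (ℕ.suc-injective c) x) }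
... | false with count≡1⇒one (f ∘ Fin.suc) c
...   | a , p , u = Fin.suc a , p , λ
  { Fin.zero q → contradiction (trans (≡-sym e) q) λ ()
  ; (Fin.suc x) q → cong Fin.suc (u x q) }

count≡2⇒Two : ∀ {t} (f : Fin t → Bool) → count f ≡ 2 → Two f
count≡2⇒Two {suc t} f c with f Fin.zero in e
... | true with count≡1⇒one (f ∘ Fin.suc) (ℕ.suc-injective c)
...   | a , p , u = record
  { fst = Fin.zero ; snd = Fin.suc a ; fst≢snd = λ () ; fst-true = e ; snd-true = p
  ; only = λ { Fin.zero _ → inj₁ refl ; (Fin.suc x) q → inj₂ (cong Fin.suc (u x q)) } }
count≡2⇒Two {suc t} f c | false with count≡2⇒Two (f ∘ Fin.suc) c
...   | F = record
  { fst = Fin.suc (fst F) ; snd = Fin.suc (snd F)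
  ; fst≢snd = λ q → fst≢snd F (Fin.suc-injective q)
  ; fst-true = fst-true F ; snd-true = snd-true F
  ; only = λ { Fin.zero q → contradiction (trans (≡-sym e) q) λ ()
             ; (Fin.suc x) q → Sum.map (cong Fin.suc) (cong Fin.suc) (only F x q) } }

Two⇒count≡2 : ∀ {t} (f : Fin t → Bool) → Two f → count f ≡ 2
Two⇒count≡2 f F = go f (fst F) (snd F) (fst≢snd F) (fst-true F) (snd-true F) (only F)
  where
  go : ∀ {t} (f : Fin t → Bool) a b → a ≢ b → f a ≡ true → f b ≡ true →
       (∀ x → f x ≡ true → x ≡ a ⊎ x ≡ b) → count f ≡ 2
  go f Fin.zero Fin.zero a≢b _ _ _ = contradiction refl a≢b
  go f Fin.zero (Fin.suc b) _ p q u with f Fin.zero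
  ... | true = cong suc (count-one (f ∘ Fin.suc) b q λ x r →
                 [ (λ ()) , Fin.suc-injective ]′ (u _ r))
  go f (Fin.suc a) Fin.zero _ p q u with f Fin.zero
  ... | true = cong suc (count-one (f ∘ Fin.suc) a p λ x r →
                 [ Fin.suc-injective , (λ ()) ]′ (u _ r))
  go f (Fin.suc a) (Fin.suc b) a≢b p q u with f Fin.zero in e
  ... | true  = ⊥-elim ([ (λ ()) , (λ ()) ]′ (u _ e))
  ... | false = go (f ∘ Fin.suc) a b (λ r → a≢b (cong Fin.suc r)) p q λ x r →
                  Sum.map Fin.suc-injective Fin.suc-injective (u _ r)

three≤count : ∀ {t} (f : Fin t → Bool) {a b} → a ≢ b → f a ≡ true → f b ≡ true →
              ¬ Two f → 3 ≤ count f
three≤count f {a} {b} a≢b p q ¬two with count f in e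
... | 0 = contradiction p (count≡0⇒none f e a)
... | 1 with count≡1⇒one f e
...   | _ , _ , u = contradiction (trans (u a p) (≡-sym (u b q))) a≢b
three≤count f a≢b p q ¬two | 2 = contradiction (count≡2⇒Two f e) ¬two
three≤count f a≢b p q ¬two | suc (suc (suc c)) = s≤s (s≤s (s≤s z≤n))

-- The matrix `C t` and two-regular submatrices.

C⁻ : ∀ {t} (i j : Fin t) → C t i j ≡ true →
     toℕ j ≡ toℕ i ⊎ toℕ j ≡ suc (toℕ i) ⊎ (toℕ i ≡ t ∸ 1 × toℕ j ≡ 0)
C⁻ {t} i j e with ∨-true⁻ {toℕ j ≡ᵇ toℕ i} e
... | inj₁ p = inj₁ (≡ᵇ⁻ p)
... | inj₂ p with ∨-true⁻ {toℕ j ≡ᵇ suc (toℕ i)} p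
...   | inj₁ q = inj₂ (inj₁ (≡ᵇ⁻ q))
...   | inj₂ q with ∧-true⁻ {toℕ i ≡ᵇ t ∸ 1} q
...     | a , b = inj₂ (inj₂ (≡ᵇ⁻ a , ≡ᵇ⁻ b))

C⁺ : ∀ {t} (i j : Fin t) →
     toℕ j ≡ toℕ i ⊎ toℕ j ≡ suc (toℕ i) ⊎ (toℕ i ≡ t ∸ 1 × toℕ j ≡ 0) → C t i j ≡ true
C⁺ i j (inj₁ p) = ∨-true⁺ (inj₁ (≡ᵇ⁺ p))
C⁺ {t} i j (inj₂ (inj₁ p)) =
  ∨-true⁺ {toℕ j ≡ᵇ toℕ i} (inj₂ (∨-true⁺ (inj₁ (≡ᵇ⁺ p))))
C⁺ {t} i j (inj₂ (inj₂ (p , q))) =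
  ∨-true⁺ {toℕ j ≡ᵇ toℕ i} (inj₂ (∨-true⁺ {toℕ j ≡ᵇ suc (toℕ i)} (inj₂ (∧-true⁺ (≡ᵇ⁺ p) (≡ᵇ⁺ q)))))

-- The bound `2 ≤ t` keeps the two entries apart: in `C 1` they coincide.
C-row-two : ∀ {t} → 2 ≤ t → (i : Fin t) → Two (C t i)
C-row-two {suc (suc t)} (s≤s (s≤s _)) i with toℕ i ℕ.≟ suc t
... | yes i≡last = record
  { fst = i ; snd = Fin.zero ; fst≢snd = λ e → contradiction (trans (≡-sym i≡last) (cong toℕ e)) λ ()
  ; fst-true = C⁺ i i (inj₁ refl) ; snd-true = C⁺ i Fin.zero (inj₂ (inj₂ (i≡last , refl)))
  ; only = λ j e → case C⁻ i j e of λ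
      { (inj₁ p)              → inj₁ (Fin.toℕ-injective p)
      ; (inj₂ (inj₁ p))       → contradiction (trans p (cong suc i≡last)) (ℕ.<⇒≢ (Fin.toℕ<n j))
      ; (inj₂ (inj₂ (_ , p))) → inj₂ (Fin.toℕ-injective p) } }
... | no i≢last = record
  { fst = i ; snd = fromℕ< si<t
  ; fst≢snd = λ e → ℕ.1+n≢n (≡-sym (trans (cong toℕ e) (Fin.toℕ-fromℕ< si<t)))
  ; fst-true = C⁺ i i (inj₁ refl) ; snd-true = C⁺ i (fromℕ< si<t) (inj₂ (inj₁ (Fin.toℕ-fromℕ< si<t)))
  ; only = λ j e → case C⁻ i j e of λ
      { (inj₁ p)              → inj₁ (Fin.toℕ-injective p)
      ; (inj₂ (inj₁ p))       → inj₂ (Fin.toℕ-injective (trans p (≡-sym (Fin.toℕ-fromℕ< si<t))))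
      ; (inj₂ (inj₂ (p , _))) → contradiction p i≢last } }
  where
  si<t : suc (toℕ i) < suc (suc t)
  si<t = s≤s (ℕ.≤∧≢⇒< (ℕ.≤-pred (Fin.toℕ<n i)) i≢last)

C-col-two : ∀ {t} → 2 ≤ t → (j : Fin t) → Two (λ i → C t i j)
C-col-two {suc (suc t)} (s≤s (s≤s _)) Fin.zero = record
  { fst = Fin.zero ; snd = Fin.fromℕ (suc t) ; fst≢snd = λ ()
  ; fst-true = refl
  ; snd-true = C⁺ (Fin.fromℕ (suc t)) Fin.zero (inj₂ (inj₂ (Fin.toℕ-fromℕ (suc t) , refl)))
  ; only = λ i e → case C⁻ i Fin.zero e of λ
      { (inj₁ p)              → inj₁ (Fin.toℕ-injective (≡-sym p))
      ; (inj₂ (inj₂ (p , _))) → inj₂ (Fin.toℕ-injective (trans p (≡-sym (Fin.toℕ-fromℕ (suc t))))) } }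
C-col-two {suc (suc t)} (s≤s (s≤s _)) (Fin.suc j) = record
  { fst = Fin.suc j ; snd = Fin.inject₁ j
  ; fst≢snd = λ e → ℕ.1+n≢n (trans (cong toℕ e) (Fin.toℕ-inject₁ j))
  ; fst-true = C⁺ (Fin.suc j) (Fin.suc j) (inj₁ refl)
  ; snd-true = C⁺ (Fin.inject₁ j) (Fin.suc j) (inj₂ (inj₁ (cong suc (≡-sym (Fin.toℕ-inject₁ j)))))
  ; only = λ i e → case C⁻ i (Fin.suc j) e of λ
      { (inj₁ p)        → inj₁ (Fin.toℕ-injective (≡-sym p))
      ; (inj₂ (inj₁ p)) → inj₂ (Fin.toℕ-injective
                            (trans (≡-sym (ℕ.suc-injective p)) (≡-sym (Fin.toℕ-inject₁ j)))) } }

-- The submatrix forbidden by `Balanced`, without its parity: the pieces cut out below are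
-- two-regular before it is known which of them has odd order.
record TwoRegular {m k} (M : Mat m k) (t : ℕ) : Set where
  field
    row     : Fin t → Fin m
    col     : Fin t → Fin k
    row-inj : Injective _≡_ _≡_ row
    col-inj : Injective _≡_ _≡_ col
    row-two : ∀ i → Two (λ j → M (row i) (col j))
    col-two : ∀ j → Two (λ i → M (row i) (col j))

TwoRegular-embed : ∀ {m k m′ k′ t} {M : Mat m k} {N : Mat m′ k′}
                   (e : Fin m′ → Fin m) (h : Fin k′ → Fin k) →
                   Injective _≡_ _≡_ e → Injective _≡_ _≡_ h →
                   (∀ i j → N i j ≡ M (e i) (h j)) → TwoRegular N t → TwoRegular M t
TwoRegular-embed e h e-inj h-inj N≡M T = record
  { row = e ∘ row ; col = h ∘ col
  ; row-inj = λ p → row-inj (e-inj p) ; col-inj = λ p → col-inj (h-inj p)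
  ; row-two = λ i → Two-cong (λ _ → N≡M _ _) (row-two i)
  ; col-two = λ j → Two-cong (λ _ → N≡M _ _) (col-two j) }
  where open TwoRegular T

C-TwoRegular : ∀ {t} → 2 ≤ t → TwoRegular (C t) t
C-TwoRegular 2≤t = record
  { row = id ; col = id ; row-inj = id ; col-inj = id
  ; row-two = C-row-two 2≤t ; col-two = C-col-two 2≤t }

NoSmaller : ∀ {m k} → Mat m k → ℕ → Set
NoSmaller M t = ∀ t′ → t′ < t → Odd t′ → ¬ TwoRegular M t′

-- Linearity in the sense of hypergraphs. It is the form in which diamond-freeness enters the chord
-- arguments.
Linear : ∀ {m k} → Mat m k → Set
Linear M = ∀ {i i′ a b} → a ≢ b →
           M i a ≡ true → M i b ≡ true → M i′ a ≡ true → M i′ b ≡ true → i ≡ i′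

-- Cyclic submatrices and their rotations.

InjectiveBelow : {A : Set} → ℕ → (ℕ → A) → Set
InjectiveBelow t u = ∀ {a b} → a < t → b < t → u a ≡ u b → a ≡ b

below : ∀ {A : Set} {t} {u : ℕ → A} → InjectiveBelow t u → Injective _≡_ _≡_ (λ (i : Fin t) → u (toℕ i))
below inj {i} {j} e = Fin.toℕ-injective (inj (Fin.toℕ<n i) (Fin.toℕ<n j) e)

-- Moving the window one place on drops the value at 0 and gains the value at `t`, which is the
-- same.
below-shift : ∀ {A : Set} {t} {u : ℕ → A} → u t ≡ u 0 → InjectiveBelow t u → InjectiveBelow t (u ∘ suc)
below-shift {t = t} {u} closed inj {a} {b} a<t b<t e
  with ℕ.m≤n⇒m<n∨m≡n a<t | ℕ.m≤n⇒m<n∨m≡n b<t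
... | inj₁ p    | inj₁ q    = ℕ.suc-injective (inj p q e)
... | inj₁ p    | inj₂ refl = contradiction (inj p (s≤s z≤n) (trans e closed)) λ ()
... | inj₂ refl | inj₁ q    = contradiction (inj q (s≤s z≤n) (trans (≡-sym e) closed)) λ ()
... | inj₂ p    | inj₂ q    = ℕ.suc-injective (trans p (≡-sym q))

-- Indices run over all naturals with period `t`, so a rotation is composition with `suc` and no
-- arithmetic modulo `t` is needed. For the same reason `only-v` compares columns and not indices.
-- Columns of `M` off the cycle are left unconstrained.
record Cycle {m k} (M : Mat m k) (t : ℕ) : Set where
  field
    v     : ℕ → Fin k
    w     : ℕ → Fin m
    2≤t   : 2 ≤ t
    v-per : ∀ a → v (a + t) ≡ v a
    w-per : ∀ a → w (a + t) ≡ w a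
    v-inj : InjectiveBelow t v
    w-inj : InjectiveBelow t w
    on    : ∀ a → M (w a) (v a) ≡ true
    on⁺   : ∀ a → M (w a) (v (suc a)) ≡ true
    only-v : ∀ a b → M (w a) (v b) ≡ true → v b ≡ v a ⊎ v b ≡ v (suc a)

Cycle-embed : ∀ {m k m′ k′ t} {M : Mat m k} {N : Mat m′ k′}
              (e : Fin m′ → Fin m) (h : Fin k′ → Fin k) →
              Injective _≡_ _≡_ e → Injective _≡_ _≡_ h →
              (∀ i j → N i j ≡ M (e i) (h j)) → Cycle N t → Cycle M t
Cycle-embed e h e-inj h-inj N≡M c = record
  { v = h ∘ v ; w = e ∘ w ; 2≤t = 2≤t ; v-per = cong h ∘ v-per ; w-per = cong e ∘ w-per
  ; v-inj = λ p q r → v-inj p q (h-inj r) ; w-inj = λ p q r → w-inj p q (e-inj r)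
  ; on = λ a → trans (≡-sym (N≡M _ _)) (on a) ; on⁺ = λ a → trans (≡-sym (N≡M _ _)) (on⁺ a)
  ; only-v = λ a b p → Sum.map (cong h) (cong h) (only-v a b (trans (N≡M _ _) p)) }
  where open Cycle c

cycle-matrix : ∀ {m k t} {M : Mat m k} (c : Cycle M t) → let open Cycle c in
               (i j : Fin t) → C t i j ≡ M (w (toℕ i)) (v (toℕ j))
cycle-matrix {t = t} {M} c i j = bool-ext to from
  where
  open Cycle c
  to : C t i j ≡ true → M (w (toℕ i)) (v (toℕ j)) ≡ true
  to e with C⁻ i j e
  ... | inj₁ p rewrite p = on _
  ... | inj₂ (inj₁ p) rewrite p = on⁺ _
  ... | inj₂ (inj₂ (p , q)) = subst (λ x → M (w (toℕ i)) x ≡ true) eq (on⁺ _)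
    where
    eq : v (suc (toℕ i)) ≡ v (toℕ j)
    eq rewrite p | q | ℕ.suc-pred t {{ℕ.>-nonZero (ℕ.≤-trans (s≤s z≤n) 2≤t)}} = v-per 0
  from : M (w (toℕ i)) (v (toℕ j)) ≡ true → C t i j ≡ true
  from e with only-v (toℕ i) (toℕ j) e | ℕ.m≤n⇒m<n∨m≡n (Fin.toℕ<n i)
  ... | inj₁ p | _         = C⁺ i j (inj₁ (v-inj (Fin.toℕ<n j) (Fin.toℕ<n i) p))
  ... | inj₂ p | inj₁ si<t = C⁺ i j (inj₂ (inj₁ (v-inj (Fin.toℕ<n j) si<t p)))
  ... | inj₂ p | inj₂ si≡t = C⁺ i j (inj₂ (inj₂ (cong ℕ.pred si≡t ,
      v-inj (Fin.toℕ<n j) (ℕ.≤-trans (s≤s z≤n) 2≤t) (trans p (trans (cong v si≡t) (v-per 0))))))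

Cycle⇒TwoRegular : ∀ {m k t} {M : Mat m k} → Cycle M t → TwoRegular M t
Cycle⇒TwoRegular c =
  TwoRegular-embed (w ∘ toℕ) (v ∘ toℕ) (below w-inj) (below v-inj) (cycle-matrix c) (C-TwoRegular 2≤t)
  where open Cycle c

rotate : ∀ {m k t} {M : Mat m k} → Cycle M t → Cycle M t
rotate c = record
  { v = v ∘ suc ; w = w ∘ suc ; 2≤t = 2≤t
  ; v-per = v-per ∘ suc ; w-per = w-per ∘ suc
  ; v-inj = below-shift {u = v} (v-per 0) v-inj ; w-inj = below-shift {u = w} (w-per 0) w-inj
  ; on = on ∘ suc ; on⁺ = on⁺ ∘ suc ; only-v = λ a b → only-v (suc a) (suc b) }
  where open Cycle c

rotateBy : ∀ {m k t} {M : Mat m k} → ℕ → Cycle M t → Cycle M t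
rotateBy zero    c = c
rotateBy (suc d) c = rotateBy d (rotate c)

v-rotateBy : ∀ {m k t} {M : Mat m k} d (c : Cycle M t) a → Cycle.v (rotateBy d c) a ≡ Cycle.v c (d + a)
v-rotateBy zero    c a = refl
v-rotateBy (suc d) c a = v-rotateBy d (rotate c) a

w-rotateBy : ∀ {m k t} {M : Mat m k} d (c : Cycle M t) a → Cycle.w (rotateBy d c) a ≡ Cycle.w c (d + a)
w-rotateBy zero    c a = refl
w-rotateBy (suc d) c a = w-rotateBy d (rotate c) a

-- Chords of an odd cycle.

-- The path from `v 0` to `v d` through the rows `w 0`, ..., `w (d - 1)` is closed by `q`, which
-- takes the place of `w d`. The result is `C (suc d)` on the columns `v 0`, ..., `v d`.
shortcut : ∀ {m k t} {M : Mat m k} (c : Cycle M t) → let open Cycle c in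
           ∀ q d → (∀ a → q ≢ w a) → M q (v 0) ≡ true → M q (v d) ≡ true →
           (∀ b → M q (v b) ≡ true → v b ≡ v 0 ⊎ v b ≡ v d) →
           1 ≤ d → d < t → TwoRegular M (suc d)
shortcut {m} {k} {t} {M} c q d q∉w q₀ q₁ q-only 1≤d d<t =
  TwoRegular-embed (r ∘ toℕ) (v ∘ toℕ) (below r-inj)
    (below λ a<sd b<sd → v-inj (ℕ.≤-trans a<sd d<t) (ℕ.≤-trans b<sd d<t)) matrix (C-TwoRegular (s≤s 1≤d))
  where
  open Cycle c
  r : ℕ → Fin m
  r a with a <? d
  ... | yes _ = w a
  ... | no  _ = q
  r-inj : InjectiveBelow (suc d) r
  r-inj {a} {b} a<sd b<sd e with a <? d | b <? d
  ... | yes p | yes p′ = w-inj (ℕ.<-trans p d<t) (ℕ.<-trans p′ d<t) e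
  ... | yes p | no  ¬p = contradiction (≡-sym e) (q∉w a)
  ... | no ¬p | yes p  = contradiction e (q∉w b)
  ... | no ¬p | no ¬p′ = trans (last a<sd ¬p) (≡-sym (last b<sd ¬p′))
    where
    last : ∀ {a} → a < suc d → ¬ a < d → a ≡ d
    last a<sd a≮d = ℕ.≤-antisym (ℕ.≤-pred a<sd) (ℕ.≮⇒≥ a≮d)
  matrix : ∀ i j → C (suc d) i j ≡ M (r (toℕ i)) (v (toℕ j))
  matrix i j with toℕ i <? d
  ... | yes i<d = bool-ext
    (λ e → case C⁻ i j e of λ
      { (inj₁ p)              → subst (λ x → M (w (toℕ i)) (v x) ≡ true) (≡-sym p) (on _)
      ; (inj₂ (inj₁ p))       → subst (λ x → M (w (toℕ i)) (v x) ≡ true) (≡-sym p) (on⁺ _)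
      ; (inj₂ (inj₂ (p , _))) → contradiction p (ℕ.<⇒≢ i<d) })
    (λ e → C⁺ i j ([ (λ p → inj₁ (v-inj j<t (ℕ.<-trans i<d d<t) p))
                           , (λ p → inj₂ (inj₁ (v-inj j<t (ℕ.≤-trans (s≤s i<d) d<t) p))) ]′
                    (only-v (toℕ i) (toℕ j) e)))
    where
    j<t : toℕ j < t
    j<t = ℕ.≤-trans (Fin.toℕ<n j) d<t
  ... | no i≮d = bool-ext
    (λ e → case C⁻ i j e of λ
      { (inj₁ p)              → subst (λ x → M q (v x) ≡ true) (≡-sym (trans p i≡d)) q₁
      ; (inj₂ (inj₁ p))       → contradiction (trans p (cong suc i≡d)) (ℕ.<⇒≢ (Fin.toℕ<n j))
      ; (inj₂ (inj₂ (_ , p))) → subst (λ x → M q (v x) ≡ true) (≡-sym p) q₀ })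
    (λ e → C⁺ i j ([ (λ p → inj₂ (inj₂ (i≡d , v-inj j<t (ℕ.≤-trans (s≤s z≤n) 2≤t) p)))
                           , (λ p → inj₁ (trans (v-inj j<t d<t p) (≡-sym i≡d))) ]′ (q-only (toℕ j) e)))
    where
    i≡d : toℕ i ≡ d
    i≡d = ℕ.≤-antisym (ℕ.≤-pred (Fin.toℕ<n i)) (ℕ.≮⇒≥ i≮d)
    j<t : toℕ j < t
    j<t = ℕ.≤-trans (Fin.toℕ<n j) d<t

-- For even `d` the shortcut has odd order `suc d`, which is too small unless `suc d` equals `t`. In
-- that case `q` and `w d` share both `v d` and `v t`, which is `v 0`, and linearity identifies
-- them.
even-chord : ∀ {m k t} {M : Mat m k} → Linear M → NoSmaller M t → (c : Cycle M t) → let open Cycle c in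
             ∀ q d → (∀ a → q ≢ w a) → M q (v 0) ≡ true → M q (v d) ≡ true →
             (∀ b → M q (v b) ≡ true → v b ≡ v 0 ⊎ v b ≡ v d) →
             1 ≤ d → d < t → ¬ (∃ λ h → d ≡ 2 * h)
even-chord {M = M} lin none c q d q∉w q₀ q₁ q-only 1≤d d<t (h , d≡2h) with ℕ.m≤n⇒m<n∨m≡n d<t
... | inj₁ sd<t = none (suc d) sd<t (h , cong suc d≡2h) (shortcut c q d q∉w q₀ q₁ q-only 1≤d d<t)
... | inj₂ refl = q∉w d (lin {a = v 0} {v d} v₀≢vd q₀ q₁ (subst (λ x → M (w d) x ≡ true) (v-per 0) (on⁺ d)) (on d))
  where
  open Cycle c
  v₀≢vd : v 0 ≢ v d
  v₀≢vd e = ℕ.<⇒≢ 1≤d (v-inj (s≤s z≤n) d<t e)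

wrap : ∀ {A : Set} {t} (u : ℕ → A) → 1 ≤ t → (∀ a → u (a + t) ≡ u a) → ∀ b → ∃ λ (j : Fin t) → u b ≡ u (toℕ j)
wrap {t = t} u 1≤t per = <-rec _ go
  where
  go : ∀ b → (∀ {b′} → b′ < b → ∃ λ (j : Fin t) → u b′ ≡ u (toℕ j)) → ∃ λ (j : Fin t) → u b ≡ u (toℕ j)
  go b rec with b <? t
  ... | yes b<t = fromℕ< b<t , cong u (≡-sym (Fin.toℕ-fromℕ< b<t))
  ... | no  b≮t with rec (ℕ.∸-monoʳ-< 1≤t (ℕ.≮⇒≥ b≮t))
  ...   | j , e = j , trans (cong u (≡-sym (ℕ.m∸n+n≡m (ℕ.≮⇒≥ b≮t)))) (trans (per (b ∸ t)) e)

-- A chord cuts the odd cycle into an odd and an even path; the even one closes up to an odd cycle.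
no-chord′ : ∀ {m k t} {M : Mat m k} → Linear M → Odd t → NoSmaller M t → (c : Cycle M t) → let open Cycle c in
            ∀ q → (∀ a → q ≢ w a) → ∀ a d e → 1 ≤ d → 1 ≤ e → (a + d) + e ≡ t →
            M q (v a) ≡ true → M q (v (a + d)) ≡ true →
            ¬ (∀ b → M q (v b) ≡ true → v b ≡ v a ⊎ v b ≡ v (a + d))
no-chord′ {t = t} {M} lin odd none c q q∉w a d e 1≤d 1≤e refl qa qb q-only with parity d | parity (e + a)
... | inj₂ even-d | _ = even-chord lin none c₁ q d
        (λ x p → q∉w (a + x) (trans p (w-rotateBy a c x)))
        (subst (λ x → M q x ≡ true) (≡-sym v₁0) qa) (subst (λ x → M q x ≡ true) (≡-sym v₁d) qb)
        (λ b p → subst₂ (λ x y → Cycle.v c₁ b ≡ x ⊎ Cycle.v c₁ b ≡ y) (≡-sym v₁0) (≡-sym v₁d)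
          (subst (λ x → x ≡ v a ⊎ x ≡ v (a + d)) (≡-sym (v-rotateBy a c b))
            (q-only (a + b) (subst (λ x → M q x ≡ true) (v-rotateBy a c b) p))))
        1≤d d<t even-d
  where
  open Cycle c
  c₁ : Cycle M t
  c₁ = rotateBy a c
  v₁0 : Cycle.v c₁ 0 ≡ v a
  v₁0 = trans (v-rotateBy a c 0) (cong v (ℕ.+-identityʳ a))
  v₁d : Cycle.v c₁ d ≡ v (a + d)
  v₁d = v-rotateBy a c d
  d<t : d < t
  d<t = ℕ.≤-<-trans (ℕ.m≤n+m d a) (ℕ.m<m+n (a + d) 1≤e)
-- The even arc is now the one running from `a + d` past the origin to `a`, of length `e + a`;
-- rotation by `a + d` makes it start at index 0.
... | inj₁ odd-d | inj₂ even-e = even-chord lin none c₂ q (e + a)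
        (λ x p → q∉w (a + d + x) (trans p (w-rotateBy (a + d) c x)))
        (subst (λ x → M q x ≡ true) (≡-sym v₂0) qb) (subst (λ x → M q x ≡ true) (≡-sym v₂e) qa)
        (λ b p → subst₂ (λ x y → Cycle.v c₂ b ≡ x ⊎ Cycle.v c₂ b ≡ y) (≡-sym v₂0) (≡-sym v₂e)
          (swap (subst (λ x → x ≡ v a ⊎ x ≡ v (a + d)) (≡-sym (v-rotateBy (a + d) c b))
            (q-only (a + d + b) (subst (λ x → M q x ≡ true) (v-rotateBy (a + d) c b) p)))))
        (ℕ.≤-trans 1≤e (ℕ.m≤m+n e a)) e+a<t even-e
  where
  open Cycle c
  c₂ : Cycle M t
  c₂ = rotateBy (a + d) c
  v₂0 : Cycle.v c₂ 0 ≡ v (a + d)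
  v₂0 = trans (v-rotateBy (a + d) c 0) (cong v (ℕ.+-identityʳ (a + d)))
  v₂e : Cycle.v c₂ (e + a) ≡ v a
  v₂e = trans (v-rotateBy (a + d) c (e + a))
          (trans (cong v (trans (≡-sym (ℕ.+-assoc (a + d) e a)) (ℕ.+-comm t a))) (v-per a))
  e+a<t : e + a < t
  e+a<t = subst (e + a <_) (trans (ℕ.+-assoc e a d) (ℕ.+-comm e (a + d))) (ℕ.m<m+n (e + a) 1≤d)
... | inj₁ odd-d | inj₁ odd-e = odd+odd≢odd odd-d odd-e
        (subst Odd (trans (cong (_+ e) (ℕ.+-comm a d)) (trans (ℕ.+-assoc d a e) (cong (d +_) (ℕ.+-comm a e)))) odd)

-- Sorting the two columns yields the offsets `a`, `d`, `e` of the chord, and periodicity extends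
-- the uniqueness of the two columns from indices below `t` to all indices.
no-chord : ∀ {m k t} {M : Mat m k} → Linear M → Odd t → NoSmaller M t → (c : Cycle M t) → let open Cycle c in
           ∀ q → (∀ a → q ≢ w a) → ¬ Two (λ (j : Fin t) → M q (v (toℕ j)))
no-chord {t = t} {M} lin odd none c q q∉w F = [ (λ lt → ordered F lt) , (λ gt → ordered (Two-swap F) gt) ]′
    (Sum.map₂ (λ ge → ℕ.≤∧≢⇒< ge (λ e → fst≢snd F (≡-sym (Fin.toℕ-injective e))))
      (ℕ.<-≤-connex (toℕ (fst F)) (toℕ (snd F))))
  where
  open Cycle c
  ordered : (F : Two (λ (j : Fin t) → M q (v (toℕ j)))) → ¬ toℕ (fst F) < toℕ (snd F)
  ordered F lt with ℕ.m≤n⇒∃[o]m+o≡n (ℕ.<⇒≤ lt) | ℕ.m≤n⇒∃[o]m+o≡n (ℕ.<⇒≤ (Fin.toℕ<n (snd F)))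
  ... | d , ad≡b | e , be≡t =
    no-chord′ lin odd none c q q∉w a d e (positive ad≡b lt) (positive be≡t (Fin.toℕ<n (snd F)))
      (trans (cong (_+ e) ad≡b) be≡t) (fst-true F)
      (subst (λ x → M q (v x) ≡ true) (≡-sym ad≡b) (snd-true F)) q-only
    where
    a : ℕ
    a = toℕ (fst F)
    positive : ∀ {x y z} → x + y ≡ z → x < z → 1 ≤ y
    positive {x} {zero}  p x<z = contradiction (trans (≡-sym (ℕ.+-identityʳ x)) p) (ℕ.<⇒≢ x<z)
    positive {x} {suc y} _ _   = s≤s z≤n
    q-only : ∀ b → M q (v b) ≡ true → v b ≡ v a ⊎ v b ≡ v (a + d)
    q-only b p with wrap v (ℕ.≤-trans (s≤s z≤n) 2≤t) v-per b
    ... | j , vb≡vj = Sum.map (λ s → trans vb≡vj (cong (v ∘ toℕ) s))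
                              (λ s → trans vb≡vj (trans (cong (v ∘ toℕ) s) (cong v (≡-sym ad≡b))))
                              (only F j (subst (λ x → M q x ≡ true) vb≡vj p))

-- Splitting a two-regular matrix into a cycle and its complement.

-- Alternately leaving a row through its other column and a column through its other row, until the
-- first repeated column.
module Walk {t} (N : Mat t t) (rows : ∀ i → Two (N i)) (cols : ∀ j → Two (λ i → N i j)) (start : Fin t) where

  -- The state is an incident pair, because a column alone does not tell which of its two rows the
  -- walk came from.
  record Flag : Set where
    constructor flag
    field
      r   : Fin t
      c   : Fin t
      r∋c : N r c ≡ true

  next : Flag → Flag
  next (flag r c r∋c) with mate (rows r) r∋c
  ... | c′ , _ , r∋c′ , _ with mate (cols c′) r∋c′
  ...   | r′ , _ , r′∋c′ , _ = flag r′ c′ r′∋c′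

  walk : ℕ → Flag
  walk zero    = flag start (fst (rows start)) (fst-true (rows start))
  walk (suc a) = next (walk a)

  v w : ℕ → Fin t
  v a = Flag.c (walk a)
  w a = Flag.r (walk a)

  on : ∀ a → N (w a) (v a) ≡ true
  on a = Flag.r∋c (walk a)

  on⁺ : ∀ a → N (w a) (v (suc a)) ≡ true
  on⁺ a = proj₁ (proj₂ (proj₂ (mate (rows (w a)) (on a))))

  v-step : ∀ a → v (suc a) ≢ v a
  v-step a = proj₁ (proj₂ (mate (rows (w a)) (on a)))

  w-step : ∀ a → w (suc a) ≢ w a
  w-step a = proj₁ (proj₂ (mate (cols (v (suc a))) (on⁺ a)))

  row-only : ∀ a x → N (w a) x ≡ true → x ≡ v a ⊎ x ≡ v (suc a)
  row-only a = proj₂ (proj₂ (proj₂ (mate (rows (w a)) (on a))))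

  col-only : ∀ a x → N x (v (suc a)) ≡ true → x ≡ w a ⊎ x ≡ w (suc a)
  col-only a = proj₂ (proj₂ (proj₂ (mate (cols (v (suc a))) (on⁺ a))))

  Repeat : ℕ → Set
  Repeat l = ∃ λ a → a < l × v a ≡ v l

  first-repeat : ∃ λ l → Repeat l × (∀ l′ → l′ < l → ¬ Repeat l′)
  first-repeat with Fin.pigeonhole (ℕ.n<1+n t) (v ∘ toℕ)
  ... | i , j , i<j , e with least {Repeat} (λ l → ℕ.anyUpTo? (λ a → v a Fin.≟ v l) l) (toℕ j) (toℕ i , i<j , e)
  ...   | l , rep , _ , min = l , rep , min

  -- The successor depends on the row and the column but not on the proof of their incidence. This
  -- carries the closing of the walk at index 0 on to every later index.
  deterministic : ∀ a b → w a ≡ w b → v a ≡ v b → w (suc a) ≡ w (suc b) × v (suc a) ≡ v (suc b)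
  deterministic a b p q = next-row , next-col
    where
    next-col : v (suc a) ≡ v (suc b)
    next-col with row-only b (v (suc a)) (subst (λ x → N x (v (suc a)) ≡ true) p (on⁺ a))
    ... | inj₁ e = contradiction (trans e (≡-sym q)) (v-step a)
    ... | inj₂ e = e
    next-row : w (suc a) ≡ w (suc b)
    next-row with col-only b (w (suc a)) (subst (λ x → N (w (suc a)) x ≡ true) next-col (on (suc a)))
    ... | inj₁ e = contradiction (trans e (≡-sym p)) (w-step a)
    ... | inj₂ e = e

  module Closed (l : ℕ) (rep : Repeat (suc l)) (min : ∀ l′ → l′ < suc l → ¬ Repeat l′) where

    v-inj : InjectiveBelow (suc l) v
    v-inj {a} {b} a<l b<l e with ℕ.<-cmp a b
    ... | tri< lt _ _ = contradiction (a , lt , e) (min b b<l)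
    ... | tri≈ _ p _  = p
    ... | tri> _ _ gt = contradiction (b , gt , ≡-sym e) (min a a<l)

    -- Equality would put `v l` into the row `w a`, whose columns are `v a` and `v (suc a)`. The
    -- first equals `v (suc l)`, against a step of the walk. The second leaves `a = l`, again
    -- against a column step, or `suc a = l`, against a row step.
    wl≢wa : ∀ a → a < suc l → v a ≡ v (suc l) → w l ≢ w a
    wl≢wa a a<sl e p with row-only a (v l) (subst (λ x → N x (v l) ≡ true) p (on l))
    ... | inj₁ q = v-step l (≡-sym (trans q e))
    ... | inj₂ q with ℕ.m≤n⇒m<n∨m≡n a<sl
    ...   | inj₂ refl = v-step l (≡-sym q)
    ...   | inj₁ sa<sl = w-step a (trans (cong w (≡-sym (v-inj (ℕ.n<1+n l) sa<sl q))) p)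

    -- The walk has no tail: a column revisited at a positive index `suc a` already has the two rows
    -- `w a` and `w (suc a)`, and `w l` is neither of them.
    closes-at-start : v (suc l) ≡ v 0
    closes-at-start = go rep
      where
      go : Repeat (suc l) → v (suc l) ≡ v 0
      go (zero  , _ , e) = ≡-sym e
      go (suc a , sa<sl , e) with col-only a (w l) (subst (λ x → N (w l) x ≡ true) (≡-sym e) (on⁺ l))
      ... | inj₂ p = contradiction p (wl≢wa (suc a) sa<sl e)
      ... | inj₁ p with row-only a (v l) (subst (λ x → N x (v l) ≡ true) p (on l))
      ...   | inj₂ q = contradiction (≡-sym (trans q e)) (v-step l)
      ...   | inj₁ q = contradiction sa<sl (ℕ.<-irrefl (cong suc (≡-sym
                         (v-inj (ℕ.n<1+n l) (ℕ.<-trans (ℕ.n<1+n a) sa<sl) q))))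

    1≤l : 1 ≤ l
    1≤l = ℕ.n≢0⇒n>0 λ l≡0 → v-step 0 (trans (cong (v ∘ suc) (≡-sym l≡0)) closes-at-start)

    row-closes-at-start : w (suc l) ≡ w 0
    row-closes-at-start with col-only l (w 0) (subst (λ x → N (w 0) x ≡ true) (≡-sym closes-at-start) (on 0))
    ... | inj₁ e = contradiction (≡-sym e) (wl≢wa 0 (s≤s z≤n) (≡-sym closes-at-start))
    ... | inj₂ e = ≡-sym e

    w-distinct : ∀ {a b} → a < b → b < suc l → w a ≢ w b
    w-distinct {a} {b} a<b b<l e with row-only a (v b) (subst (λ x → N x (v b) ≡ true) (≡-sym e) (on b))
    ... | inj₁ q = min b b<l (a , a<b , ≡-sym q)
    ... | inj₂ q with v-inj b<l (ℕ.≤-<-trans a<b b<l) q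
    ...   | refl = w-step a (≡-sym e)

    w-inj : InjectiveBelow (suc l) w
    w-inj {a} {b} a<l b<l e with ℕ.<-cmp a b
    ... | tri< lt _ _ = contradiction e (w-distinct lt b<l)
    ... | tri≈ _ p _  = p
    ... | tri> _ _ gt = contradiction (≡-sym e) (w-distinct gt a<l)

    periodic : ∀ a → w (a + suc l) ≡ w a × v (a + suc l) ≡ v a
    periodic zero    = row-closes-at-start , closes-at-start
    periodic (suc a) with periodic a
    ... | p , q = deterministic (a + suc l) a p q

    cycle : Cycle N (suc l)
    cycle = record
      { v = v ; w = w ; 2≤t = s≤s 1≤l ; v-per = proj₂ ∘ periodic ; w-per = proj₁ ∘ periodic
      ; v-inj = v-inj ; w-inj = w-inj ; on = on ; on⁺ = on⁺ ; only-v = λ a b → row-only a (v b) }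

    -- A row of the cycle has both its columns on the cycle, and a column both its rows. So the
    -- remaining rows and columns keep their two 1's among themselves, and equally many of each
    -- remain.
    rest : ∃ λ s → s + suc l ≡ t × TwoRegular N s
    rest with complement (v ∘ toℕ) (below v-inj) | complement (w ∘ toℕ) (below w-inj)
    ... | s , s+l , h , h-inj , h∉v , h-cover | s′ , s′+l , g , g-inj , g∉w , g-cover
      with ℕ.+-cancelʳ-≡ (suc l) s s′ (trans s+l (≡-sym s′+l))
    ...   | refl = s , s+l , record
      { row = g ; col = h ; row-inj = g-inj ; col-inj = h-inj
      ; row-two = λ i → Two-restrict h h-inj (λ x e → [ (λ (b , p) → contradiction
          (subst (λ x → N (g i) x ≡ true) (≡-sym p) e) (not-in-v i (toℕ b))) , id ]′ (h-cover x)) (rows (g i))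
      ; col-two = λ j → Two-restrict g g-inj (λ x e → [ (λ (b , p) → contradiction
          (subst (λ x → N x (h j) ≡ true) (≡-sym p) e) (not-in-w j (toℕ b))) , id ]′ (g-cover x)) (cols (h j)) }
      where
      g≢w : ∀ i a → g i ≢ w a
      g≢w i a p with wrap w (s≤s z≤n) (proj₁ ∘ periodic) a
      ... | b , q = g∉w i b (trans p q)
      h≢v : ∀ i a → h i ≢ v a
      h≢v i a p with wrap v (s≤s z≤n) (proj₂ ∘ periodic) a
      ... | b , q = h∉v i b (trans p q)
      not-in-v : ∀ i a → N (g i) (v a) ≢ true
      -- `col-only` speaks of columns with positive index, so `v 0` is treated as `v (suc l)`.
      not-in-v i zero    e =
        [ g≢w i l , g≢w i (suc l) ]′ (col-only l (g i) (subst (λ x → N (g i) x ≡ true) (≡-sym closes-at-start) e))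
      not-in-v i (suc a) e = [ g≢w i a , g≢w i (suc a) ]′ (col-only a (g i) e)
      not-in-w : ∀ j a → N (w a) (h j) ≢ true
      not-in-w j a e = [ h≢v j a , h≢v j (suc a) ]′ (row-only a (h j) e)

    length≤ : suc l ≤ t
    length≤ = Fin.injective⇒≤ (below v-inj)

minimal⇒cycle : ∀ {m k t} {M : Mat m k} → Odd t → NoSmaller M t → TwoRegular M t → Cycle M t
minimal⇒cycle {t = t} {M} odd none T = build first-repeat
  where
  open TwoRegular T
  N : Mat t t
  N i j = M (row i) (col j)
  start : ∀ {t} → Odd t → Fin t
  start (_ , refl) = Fin.zero
  open Walk N row-two col-two (start odd)
  build : (∃ λ l → Repeat l × (∀ l′ → l′ < l → ¬ Repeat l′)) → Cycle M t
  build (zero  , (_ , () , _) , _)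
  build (suc l , rep , min) =
    subst (Cycle M) full (Cycle-embed row col row-inj col-inj (λ _ _ → refl) cycle)
    where
    open Closed l rep min using (cycle; rest; length≤)
    embed : ∀ {s} → TwoRegular N s → TwoRegular M s
    embed = TwoRegular-embed row col row-inj col-inj λ _ _ → refl
    full : suc l ≡ t
    full with ℕ.m≤n⇒m<n∨m≡n length≤
    ... | inj₂ e  = e
    ... | inj₁ lt with parity (suc l) | rest
    ...   | inj₁ odd-l  | _ = contradiction (embed (Cycle⇒TwoRegular cycle)) (none (suc l) lt odd-l)
    ...   | inj₂ even-l | s , s+l , S = contradiction (embed S)
              (none s (subst (s <_) s+l (ℕ.m<m+n s (s≤s z≤n))) (odd-summand even-l (subst Odd (≡-sym s+l) odd)))

-- Finding an odd two-regular submatrix by finite search.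

lookup-injective : ∀ {A : Set} {xs : List A} → Unique xs → Injective _≡_ _≡_ (List.lookup xs)
lookup-injective (x∉ ∷ u) {Fin.zero}  {Fin.zero}  _ = refl
lookup-injective (x∉ ∷ u) {Fin.zero}  {Fin.suc j} e = contradiction e (All.lookup x∉ (∈-lookup j))
lookup-injective (x∉ ∷ u) {Fin.suc i} {Fin.zero}  e = contradiction (≡-sym e) (All.lookup x∉ (∈-lookup i))
lookup-injective (x∉ ∷ u) {Fin.suc i} {Fin.suc j} e = cong Fin.suc (lookup-injective u e)

∃Vec? : ∀ {m} t {P : Vec (Fin m) t → Set} → (∀ xs → Dec (P xs)) → Dec (∃ P)
∃Vec? zero    P? = map′ (λ p → Vec.[] , p) (λ { (Vec.[] , p) → p }) (P? Vec.[])
∃Vec? (suc t) P? = map′ (λ (x , xs , p) → x Vec.∷ xs , p) (λ { (x Vec.∷ xs , p) → x , xs , p })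
                        (Fin.any? λ x → ∃Vec? t λ xs → P? (x Vec.∷ xs))

Odd? : ∀ n → Dec (Odd n)
Odd? n with parity n
... | inj₁ odd        = yes odd
... | inj₂ (k , refl) = no λ (h , e) → ℕ.even≢odd k h e

TwoRegular⇒¬Balanced : ∀ {m k t} {M : Mat m k} → Odd t → TwoRegular M t → ¬ Balanced M
TwoRegular⇒¬Balanced odd T bal =
  bal _ odd row row-inj col col-inj ((λ i → Two⇒count≡2 _ (row-two i)) , (λ j → Two⇒count≡2 _ (col-two j)))
  where open TwoRegular T

-- Injectivity of the column selection bounds the order by `k`, so the search is finite. Selections
-- are ranged over as vectors, because functions can be listed only up to pointwise equality.
¬Balanced⇒TwoRegular : ∀ {m k} (M : Mat m k) → ¬ Balanced M → ∃ λ t → Odd t × TwoRegular M t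
¬Balanced⇒TwoRegular {m} {k} M ¬bal with ℕ.anyUpTo? Witness? (suc k)
  where
  Good : (t : ℕ) → Vec (Fin m) t → Vec (Fin k) t → Set
  Good t r c = (∀ i j → lookup r i ≡ lookup r j → i ≡ j) × (∀ i j → lookup c i ≡ lookup c j → i ≡ j) ×
               (∀ i → count (λ j → M (lookup r i) (lookup c j)) ≡ 2) ×
               (∀ j → count (λ i → M (lookup r i) (lookup c j)) ≡ 2)
  Witness : ℕ → Set
  Witness t = Odd t × ∃ λ r → ∃ λ c → Good t r c
  Witness? : ∀ t → Dec (Witness t)
  Witness? t = Odd? t ×-dec ∃Vec? t λ r → ∃Vec? t λ c →
    Fin.all? (λ i → Fin.all? λ j → (lookup r i Fin.≟ lookup r j) →-dec (i Fin.≟ j)) ×-dec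
    Fin.all? (λ i → Fin.all? λ j → (lookup c i Fin.≟ lookup c j) →-dec (i Fin.≟ j)) ×-dec
    Fin.all? (λ i → _ ℕ.≟ _) ×-dec Fin.all? (λ j → _ ℕ.≟ _)
... | yes (t , _ , odd , r , c , r-inj , c-inj , r₂ , c₂) = t , odd , record
  { row = lookup r ; col = lookup c ; row-inj = r-inj _ _ ; col-inj = c-inj _ _
  ; row-two = λ i → count≡2⇒Two _ (r₂ i) ; col-two = λ j → count≡2⇒Two _ (c₂ j) }
... | no none = contradiction balanced ¬bal
  where
  balanced : Balanced M
  balanced t odd r r-inj c c-inj (r₂ , c₂) = none
    (t , s≤s (Fin.injective⇒≤ c-inj) , odd , tabulate r , tabulate c
    , (λ i j e → r-inj (subst₂ _≡_ (rt i) (rt j) e)) , (λ i j e → c-inj (subst₂ _≡_ (ct i) (ct j) e))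
    , (λ i → Two⇒count≡2 _ (Two-cong (λ j → ≡-sym (cong₂ M (rt i) (ct j))) (count≡2⇒Two _ (r₂ i))))
    , (λ j → Two⇒count≡2 _ (Two-cong (λ i → ≡-sym (cong₂ M (rt i) (ct j))) (count≡2⇒Two _ (c₂ j)))))
    where
    rt : ∀ i → lookup (tabulate r) i ≡ r i
    rt = Vec.lookup∘tabulate r
    ct : ∀ i → lookup (tabulate c) i ≡ c i
    ct = Vec.lookup∘tabulate c

-- Maximal cliques as the rows of the clique matrix, and the effect of diamond-freeness.

∈-allSubsets : ∀ {n} (S : Vec Bool n) → S ∈ allSubsets n
∈-allSubsets Vec.[] = here refl
∈-allSubsets (true Vec.∷ S)  = ∈-++⁺ˡ (∈-map⁺ (true Vec.∷_) (∈-allSubsets S))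
∈-allSubsets (false Vec.∷ S) = ∈-++⁺ʳ (map (true Vec.∷_) (allSubsets _)) (∈-map⁺ (false Vec.∷_) (∈-allSubsets S))

allSubsets-unique : ∀ n → Unique (allSubsets n)
allSubsets-unique zero    = [] ∷ []
allSubsets-unique (suc n) = Unique.++⁺
  (Unique.map⁺ Vec.∷-injectiveʳ (allSubsets-unique n)) (Unique.map⁺ Vec.∷-injectiveʳ (allSubsets-unique n))
  λ (p , q) → case (∈-map⁻ (true Vec.∷_) p , ∈-map⁻ (false Vec.∷_) q) of λ
    { ((_ , _ , refl) , (_ , _ , ())) }

lookup-ext : ∀ {n} (S S′ : Vec Bool n) → (∀ x → lookup S x ≡ lookup S′ x) → S ≡ S′
lookup-ext S S′ e = trans (≡-sym (Vec.tabulate∘lookup S)) (trans (Vec.tabulate-cong e) (Vec.tabulate∘lookup S′))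

module Cliques {n} (G : Graph n) where

  IsClique : Vec Bool n → Set
  IsClique S = ∀ i j → lookup S i ≡ true → lookup S j ≡ true → i ≡ j ⊎ adj G i j ≡ true

  Maximal : Vec Bool n → Set
  Maximal S = ∀ x → (∀ y → lookup S y ≡ true → y ≡ x ⊎ adj G y x ≡ true) → lookup S x ≡ true

  isClique⁻ : ∀ S → isClique G S ≡ true → IsClique S
  isClique⁻ S e i j p q
    with ∨-true⁻ (implies-true⁻ (all⁻ (λ j → _) (all⁻ (λ i → _) e (∈-allFin i)) (∈-allFin j)) (∧-true⁺ p q))
  ... | inj₁ i==j = inj₁ (==⁻ i==j)
  ... | inj₂ i~j  = inj₂ i~j

  isClique⁺ : ∀ S → IsClique S → isClique G S ≡ true
  isClique⁺ S cl = all⁺ _ (allFin n) λ i → all⁺ _ (allFin n) λ j → implies-true⁺ λ e →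
    ∨-true⁺ (Sum.map₁ ==⁺ (cl i j (proj₁ (∧-true⁻ e)) (proj₂ (∧-true⁻ {lookup S i} e))))

  insert : Vec Bool n → Fin n → Vec Bool n
  insert S x = updateAt S x (λ _ → true)

  insert⁻ : ∀ S x y → lookup (insert S x) y ≡ true → y ≡ x ⊎ lookup S y ≡ true
  insert⁻ S x y e with y Fin.≟ x
  ... | yes y≡x = inj₁ y≡x
  ... | no  y≢x = inj₂ (trans (≡-sym (Vec.lookup∘updateAt′ y x y≢x S)) e)

  insert⁺ : ∀ S x y → y ≡ x ⊎ lookup S y ≡ true → lookup (insert S x) y ≡ true
  insert⁺ S x y p with y Fin.≟ x
  ... | yes refl = Vec.lookup∘updateAt x S
  ... | no  y≢x  = trans (Vec.lookup∘updateAt′ y x y≢x S) ([ (λ e → contradiction e y≢x) , id ]′ p)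

  adj-sym : ∀ {x y} → adj G x y ≡ true → adj G y x ≡ true
  adj-sym {x} {y} e = trans (Graph.sym G y x) e

  adj⇒≢ : ∀ {x y} → adj G x y ≡ true → x ≢ y
  adj⇒≢ {x} e refl = contradiction (trans (≡-sym e) (irrefl G x)) λ ()

  isMaximal⁻ : ∀ S → isMaximalClique G S ≡ true → IsClique S × Maximal S
  isMaximal⁻ S e = cl , max
    where
    cl : IsClique S
    cl = isClique⁻ S (proj₁ (∧-true⁻ e))
    max : Maximal S
    max x nbr with ∨-true⁻ {lookup S x} (all⁻ (λ v → _) (proj₂ (∧-true⁻ {isClique G S} e)) (∈-allFin x))
    ... | inj₁ p = p
    ... | inj₂ p = contradiction (trans (≡-sym p) (cong not (isClique⁺ (insert S x) bigger))) λ ()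
      where
      bigger : IsClique (insert S x)
      bigger i j p q with insert⁻ S x i p | insert⁻ S x j q
      ... | inj₁ refl | inj₁ refl = inj₁ refl
      ... | inj₁ refl | inj₂ j∈   = Sum.map ≡-sym adj-sym (nbr j j∈)
      ... | inj₂ i∈   | inj₁ refl = nbr i i∈
      ... | inj₂ i∈   | inj₂ j∈   = cl i j i∈ j∈

  isMaximal⁺ : ∀ S → IsClique S → Maximal S → isMaximalClique G S ≡ true
  isMaximal⁺ S cl max = ∧-true⁺ (isClique⁺ S cl) (all⁺ _ (allFin n) go)
    where
    go : ∀ x → lookup S x ∨ not (isClique G (insert S x)) ≡ true
    go x with isClique G (insert S x) in e
    ... | false = ∨-true⁺ {lookup S x} (inj₂ refl)
    ... | true  = ∨-true⁺ (inj₁ (max x λ y y∈ →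
                    isClique⁻ (insert S x) e y x (insert⁺ S x y (inj₂ y∈)) (insert⁺ S x x (inj₁ refl))))

  rowSet : Fin (length (maximalCliques G)) → Vec Bool n
  rowSet = List.lookup (maximalCliques G)

  A : Mat (length (maximalCliques G)) n
  A = cliqueMatrix G

  row-maximal-clique : ∀ i → IsClique (rowSet i) × Maximal (rowSet i)
  row-maximal-clique i = isMaximal⁻ (rowSet i) (Equivalence.to T-≡
    (proj₂ (∈-filter⁻ (T? ∘ isMaximalClique G) {xs = allSubsets n} (∈-lookup i))))

  row-of : ∀ S → IsClique S → Maximal S → ∃ λ i → rowSet i ≡ S
  row-of S cl max = index S∈ , ≡-sym (lookup-index S∈)
    where
    S∈ : S ∈ maximalCliques G
    S∈ = ∈-filter⁺ (T? ∘ isMaximalClique G) (∈-allSubsets S) (Equivalence.from T-≡ (isMaximal⁺ S cl max))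

  rowSet-injective : Injective _≡_ _≡_ rowSet
  rowSet-injective = lookup-injective (Unique.filter⁺ (T? ∘ isMaximalClique G) (allSubsets-unique n))

  row-adj : ∀ {i a b} → a ≢ b → A i a ≡ true → A i b ≡ true → adj G a b ≡ true
  row-adj a≢b p q = [ (λ e → contradiction e a≢b) , id ]′ (proj₁ (row-maximal-clique _) _ _ p q)

  -- The empty set can be extended by `x₀`, and a single vertex by one of its neighbours, so neither
  -- is a maximal clique.
  two-in-row : (∀ x → ∃ λ y → adj G x y ≡ true) → Fin n → ∀ i →
               ∃ λ a → ∃ λ b → a ≢ b × A i a ≡ true × A i b ≡ true
  two-in-row nbr x₀ i with Fin.any? (λ a → A i a Bool.≟ true)
  ... | no none = contradiction
        (x₀ , proj₂ (row-maximal-clique i) x₀ λ y y∈ → contradiction (y , y∈) none) none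
  ... | yes (a , a∈) with Fin.any? (λ b → ¬? (a Fin.≟ b) ×-dec (A i b Bool.≟ true))
  ...   | yes (b , a≢b , b∈) = a , b , a≢b , a∈ , b∈
  ...   | no none with nbr a
  ...     | b , a~b = contradiction (b , adj⇒≢ a~b , proj₂ (row-maximal-clique i) b nbr-b) none
    where
    nbr-b : ∀ y → A i y ≡ true → y ≡ b ⊎ adj G y b ≡ true
    nbr-b y y∈ with a Fin.≟ y
    ... | yes refl = inj₂ a~b
    ... | no  a≢y  = contradiction (y , a≢y , y∈) none

  module _ (df : DiamondFree G) where

    -- Otherwise `a`, `b`, `x`, `y` would be a diamond with `x`, `y` as its missing edge.
    common-neighbour : ∀ {a b x y} → adj G a b ≡ true → adj G x a ≡ true → adj G x b ≡ true →
                       adj G y a ≡ true → adj G y b ≡ true → x ≡ y ⊎ adj G x y ≡ true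
    common-neighbour {a} {b} {x} {y} ab xa xb ya yb with x Fin.≟ y | adj G x y in xy
    ... | yes x≡y | _     = inj₁ x≡y
    ... | no  x≢y | true  = inj₂ refl
    ... | no  x≢y | false = contradiction (ab , adj-sym xa , adj-sym ya , adj-sym xb , adj-sym yb , xy)
      (df a b x y (adj⇒≢ ab) (adj⇒≢ (adj-sym xa)) (adj⇒≢ (adj-sym ya))
        (adj⇒≢ (adj-sym xb)) (adj⇒≢ (adj-sym yb)) x≢y)

    -- Every other vertex of the clique is, like `x`, a common neighbour of `a` and `b`, hence
    -- adjacent to `x`; maximality then admits `x`. Uniqueness of the maximal clique through an edge
    -- follows from this.
    row-absorbs : ∀ {i a b x} → a ≢ b → A i a ≡ true → A i b ≡ true →
                  adj G x a ≡ true → adj G x b ≡ true → A i x ≡ true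
    row-absorbs {i} {a} {b} {x} a≢b a∈ b∈ xa xb = proj₂ (row-maximal-clique i) x go
      where
      go : ∀ y → A i y ≡ true → y ≡ x ⊎ adj G y x ≡ true
      go y y∈ with y Fin.≟ a | y Fin.≟ b
      ... | yes refl | _        = inj₂ (adj-sym xa)
      ... | no  _    | yes refl = inj₂ (adj-sym xb)
      ... | no  y≢a  | no  y≢b  =
        common-neighbour (row-adj a≢b a∈ b∈) (row-adj y≢a y∈ a∈) (row-adj y≢b y∈ b∈) xa xb

    -- No greedy extension is required: the ends of the edge and all their common neighbours already
    -- form a maximal clique.
    row-of-edge : ∀ {a b} → adj G a b ≡ true → ∃ λ i → A i a ≡ true × A i b ≡ true
    row-of-edge {a} {b} ab = from-row (row-of S cl max)
      where
      S : Vec Bool n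
      S = tabulate λ x → (x == a) ∨ (x == b) ∨ (adj G x a ∧ adj G x b)
      Near : Fin n → Set
      Near x = x ≡ a ⊎ x ≡ b ⊎ (adj G x a ≡ true × adj G x b ≡ true)
      S⁻ : ∀ x → lookup S x ≡ true → Near x
      S⁻ x e with ∨-true⁻ {x == a} (trans (≡-sym (Vec.lookup∘tabulate _ x)) e)
      ... | inj₁ p = inj₁ (==⁻ p)
      ... | inj₂ p with ∨-true⁻ {x == b} p
      ...   | inj₁ q = inj₂ (inj₁ (==⁻ q))
      ...   | inj₂ q = inj₂ (inj₂ (proj₁ (∧-true⁻ q) , proj₂ (∧-true⁻ {adj G x a} q)))
      S⁺ : ∀ x → Near x → lookup S x ≡ true
      S⁺ x p = trans (Vec.lookup∘tabulate _ x) (∨-true⁺ (Sum.map ==⁺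
        (λ q → ∨-true⁺ (Sum.map ==⁺ (λ (xa , xb) → ∧-true⁺ xa xb) q)) p))
      near-clique : ∀ {x y} → Near x → Near y → x ≡ y ⊎ adj G x y ≡ true
      near-clique (inj₁ refl)        (inj₁ refl)              = inj₁ refl
      near-clique (inj₁ refl)        (inj₂ (inj₁ refl))       = inj₂ ab
      near-clique (inj₁ refl)        (inj₂ (inj₂ (ya , _)))   = inj₂ (adj-sym ya)
      near-clique (inj₂ (inj₁ refl)) (inj₁ refl)              = inj₂ (adj-sym ab)
      near-clique (inj₂ (inj₁ refl)) (inj₂ (inj₁ refl))       = inj₁ refl
      near-clique (inj₂ (inj₁ refl)) (inj₂ (inj₂ (_ , yb)))   = inj₂ (adj-sym yb)
      near-clique (inj₂ (inj₂ (xa , _))) (inj₁ refl)          = inj₂ xa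
      near-clique (inj₂ (inj₂ (_ , xb))) (inj₂ (inj₁ refl))   = inj₂ xb
      near-clique (inj₂ (inj₂ (xa , xb))) (inj₂ (inj₂ (ya , yb))) = common-neighbour ab xa xb ya yb
      cl : IsClique S
      cl x y p q = near-clique (S⁻ x p) (S⁻ y q)
      a∈ : lookup S a ≡ true
      a∈ = S⁺ a (inj₁ refl)
      b∈ : lookup S b ≡ true
      b∈ = S⁺ b (inj₂ (inj₁ refl))
      max : Maximal S
      max x nbr with nbr a a∈ | nbr b b∈
      ... | inj₁ refl | _         = a∈
      ... | inj₂ _    | inj₁ refl = b∈
      ... | inj₂ ax   | inj₂ bx   = S⁺ x (inj₂ (inj₂ (adj-sym ax , adj-sym bx)))
      from-row : (∃ λ i → rowSet i ≡ S) → ∃ λ i → A i a ≡ true × A i b ≡ true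
      from-row (i , e) = i , subst (λ X → lookup X a ≡ true) (≡-sym e) a∈
                           , subst (λ X → lookup X b ≡ true) (≡-sym e) b∈

    linear : Linear A
    linear {i} {i′} {a} {b} a≢b ia ib i′a i′b = rowSet-injective (lookup-ext (rowSet i) (rowSet i′)
      λ x → bool-ext (⊆ ia ib i′a i′b x) (⊆ i′a i′b ia ib x))
      where
      ⊆ : ∀ {i i′} → A i a ≡ true → A i b ≡ true → A i′ a ≡ true → A i′ b ≡ true →
          ∀ x → A i x ≡ true → A i′ x ≡ true
      ⊆ ia ib i′a i′b x ix with x Fin.≟ a | x Fin.≟ b
      ... | yes refl | _        = i′a
      ... | no  _    | yes refl = i′b
      ... | no  x≢a  | no  x≢b  = row-absorbs a≢b i′a i′b (row-adj x≢a ix ia) (row-adj x≢b ix ib)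

-- Two vertices of a two-regular submatrix in a common row span an edge, and every edge lies in exactly one
-- maximal clique; so the submatrix depends only on the adjacencies between its columns.
transfer : ∀ {n₁ n₂ t} {G₁ : Graph n₁} {G₂ : Graph n₂} → DiamondFree G₁ → DiamondFree G₂ →
           (T : TwoRegular (cliqueMatrix G₁) t) → let open TwoRegular T in
           (c : Fin t → Fin n₂) → Injective _≡_ _≡_ c →
           (∀ i j → adj G₂ (c i) (c j) ≡ adj G₁ (col i) (col j)) → TwoRegular (cliqueMatrix G₂) t
transfer {t = t} {G₁} {G₂} df₁ df₂ T c c-inj adj-eq = record
  { row = row₂ ; col = c ; row-inj = row₂-inj ; col-inj = c-inj
  ; row-two = λ i → Two-cong (λ j → agree i j) (row-two i)
  ; col-two = λ j → Two-cong (λ i → agree i j) (col-two j) }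
  where
  open TwoRegular T
  module G₁ = Cliques G₁
  module G₂ = Cliques G₂
  a b : Fin t → Fin t
  a i = fst (row-two i)
  b i = snd (row-two i)
  col-distinct : ∀ i → col (a i) ≢ col (b i)
  col-distinct i e = fst≢snd (row-two i) (col-inj e)
  spanned : ∀ i → ∃ λ r → G₂.A r (c (a i)) ≡ true × G₂.A r (c (b i)) ≡ true
  spanned i = G₂.row-of-edge df₂ (trans (adj-eq _ _)
    (G₁.row-adj (col-distinct i) (fst-true (row-two i)) (snd-true (row-two i))))
  row₂ : Fin t → Fin _
  row₂ i = proj₁ (spanned i)
  agree : ∀ i j → G₁.A (row i) (col j) ≡ G₂.A (row₂ i) (c j)
  agree i j = bool-ext to from
    where
    to : G₁.A (row i) (col j) ≡ true → G₂.A (row₂ i) (c j) ≡ true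
    to e with only (row-two i) j e
    ... | inj₁ refl = proj₁ (proj₂ (spanned i))
    ... | inj₂ refl = proj₂ (proj₂ (spanned i))
    from : G₂.A (row₂ i) (c j) ≡ true → G₁.A (row i) (col j) ≡ true
    from e with j Fin.≟ a i | j Fin.≟ b i
    ... | yes refl | _        = fst-true (row-two i)
    ... | no  _    | yes refl = snd-true (row-two i)
    -- A third column in the new row would be adjacent to both spanning columns, in `G₁` as well,
    -- and so the old row would contain it already.
    ... | no  j≢a  | no  j≢b  = G₁.row-absorbs df₁ (col-distinct i) (fst-true (row-two i)) (snd-true (row-two i))
        (near j≢a (proj₁ (proj₂ (spanned i)))) (near j≢b (proj₂ (proj₂ (spanned i))))
      where
      near : ∀ {x} → j ≢ x → G₂.A (row₂ i) (c x) ≡ true → adj G₁ (col j) (col x) ≡ true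
      near j≢x x∈ = trans (≡-sym (adj-eq _ _)) (G₂.row-adj (λ p → j≢x (c-inj p)) e x∈)
  row₂-inj : Injective _≡_ _≡_ row₂
  row₂-inj {i} {i′} e = row-inj (G₁.linear df₁ (col-distinct i)
    (fst-true (row-two i)) (snd-true (row-two i))
    (in-row′ (a i) (proj₁ (proj₂ (spanned i)))) (in-row′ (b i) (proj₂ (proj₂ (spanned i)))))
    where
    in-row′ : ∀ x → G₂.A (row₂ i) (c x) ≡ true → G₁.A (row i′) (col x) ≡ true
    in-row′ x p = trans (agree i′ x) (subst (λ r → G₂.A r (c x) ≡ true) e p)

induced-DiamondFree : ∀ {n k} (G : Graph n) (f : Fin k → Fin n) → Injective _≡_ _≡_ f →
                      DiamondFree G → DiamondFree (induced G f)
induced-DiamondFree G f inj df a b c d ab ac ad bc bd cd =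
  df (f a) (f b) (f c) (f d) (λ e → ab (inj e)) (λ e → ac (inj e)) (λ e → ad (inj e))
     (λ e → bc (inj e)) (λ e → bd (inj e)) (λ e → cd (inj e))

-- Congruence of matrices.

module _ {a b : ℕ} (σ : Fin a ↔ Fin b) where
  open Inverse σ

  to-injective : Injective _≡_ _≡_ to
  to-injective {x} {y} e = trans (≡-sym (strictlyInverseʳ x)) (trans (cong from e) (strictlyInverseʳ y))

  from-injective : Injective _≡_ _≡_ from
  from-injective {x} {y} e = trans (≡-sym (strictlyInverseˡ x)) (trans (cong to e) (strictlyInverseˡ y))

≅-intro : ∀ {m k p s} {M : Mat m k} {N : Mat p s} (g : Fin p → Fin m) (h : Fin s → Fin k) →
          Injective _≡_ _≡_ g → Injective _≡_ _≡_ h →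
          (∀ x → ∃ λ i → g i ≡ x) → (∀ y → ∃ λ j → h j ≡ y) →
          (∀ i j → N i j ≡ M (g i) (h j)) → M ≅ N
≅-intro {M = M} g h g-inj h-inj g-surj h-surj N≡M =
  inverse g g-inj g-surj , inverse h h-inj h-surj ,
  λ i j → ≡-sym (trans (N≡M _ _) (cong₂ M (proj₂ (g-surj i)) (proj₂ (h-surj j))))
  where
  inverse : ∀ {a b} (f : Fin b → Fin a) → Injective _≡_ _≡_ f → (∀ x → ∃ λ i → f i ≡ x) → Fin a ↔ Fin b
  inverse f inj surj =
    mk↔ₛ′ (proj₁ ∘ surj) f (λ y → inj (proj₂ (surj (f y)))) (proj₂ ∘ surj)

module _ {m k m′ k′} {M : Mat m k} {N : Mat m′ k′} (M≅N : M ≅ N) where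
  private
    σ = proj₁ M≅N
    τ = proj₁ (proj₂ M≅N)

  ≅-entry : ∀ i j → N i j ≡ M (Inverse.from σ i) (Inverse.from τ j)
  ≅-entry i j = ≡-sym (trans (proj₂ (proj₂ M≅N) _ _)
    (cong₂ N (Inverse.strictlyInverseˡ σ i) (Inverse.strictlyInverseˡ τ j)))

  TwoRegular-≅ˡ : ∀ {t} → TwoRegular N t → TwoRegular M t
  TwoRegular-≅ˡ = TwoRegular-embed _ _ (from-injective σ) (from-injective τ) ≅-entry

  TwoRegular-≅ʳ : ∀ {t} → TwoRegular M t → TwoRegular N t
  TwoRegular-≅ʳ = TwoRegular-embed _ _ (to-injective σ) (to-injective τ) (proj₂ (proj₂ M≅N))

  Linear-≅ : Linear M → Linear N
  Linear-≅ lin a≢b ia ib i′a i′b = from-injective σ (lin (λ e → a≢b (from-injective τ e))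
    (back ia) (back ib) (back i′a) (back i′b))
    where
    back : ∀ {i j} → N i j ≡ true → M (Inverse.from σ i) (Inverse.from τ j) ≡ true
    back e = trans (≡-sym (≅-entry _ _)) e

-- Domination, up-matrices and stacked matrices.

not-true⁺ : ∀ {b} → b ≢ true → not b ≡ true
not-true⁺ {true}  p = contradiction refl p
not-true⁺ {false} _ = refl

not-true⁻ : ∀ {b} → not b ≡ true → b ≢ true
not-true⁻ {false} _ ()

module _ {m k} (M : Mat m k) where

  dominated⁺ : ∀ {i i′} → i′ ≢ i → (∀ j → M i j ≡ true → M i′ j ≡ true) → dominated M i ≡ true
  dominated⁺ {i} {i′} i′≢i ≤ᵣ = any⁺ _ (∈-allFin i′)
    (∧-true⁺ (not-true⁺ {i′ == i} (λ e → i′≢i (==⁻ e))) (all⁺ _ (allFin k) λ j → implies-true⁺ (≤ᵣ j)))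

  dominated⁻ : ∀ {i} → dominated M i ≡ true → ∃ λ i′ → i′ ≢ i × (∀ j → M i j ≡ true → M i′ j ≡ true)
  dominated⁻ {i} e with any⁻ _ (allFin m) e
  ... | i′ , p = i′ , (λ q → not-true⁻ (proj₁ (∧-true⁻ {not (i′ == i)} p)) (==⁺ q)) ,
    λ j → implies-true⁻ (all⁻ _ (proj₂ (∧-true⁻ {not (i′ == i)} p)) (∈-allFin j))

  upRow : Fin (length (upRows M)) → Fin m
  upRow = List.lookup (upRows M)

  upRow-injective : Injective _≡_ _≡_ upRow
  upRow-injective = lookup-injective (Unique.filter⁺ (T? ∘ λ i → not (dominated M i)) (Unique.allFin⁺ m))

  upRow-undominated : ∀ x → dominated M (upRow x) ≢ true
  upRow-undominated x = not-true⁻ (Equivalence.to T-≡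
    (proj₂ (∈-filter⁻ (T? ∘ λ i → not (dominated M i)) {xs = allFin m} (∈-lookup x))))

  undominated-upRow : ∀ i → dominated M i ≢ true → ∃ λ x → upRow x ≡ i
  undominated-upRow i nd = index i∈ , ≡-sym (lookup-index i∈)
    where
    i∈ : i ∈ upRows M
    i∈ = ∈-filter⁺ (T? ∘ λ i → not (dominated M i)) (∈-allFin i) (Equivalence.from T-≡ (not-true⁺ nd))

splitAt-injective : ∀ n {p} {i i′ : Fin (n + p)} → splitAt n i ≡ splitAt n i′ → i ≡ i′
splitAt-injective n {p} {i} {i′} e =
  trans (≡-sym (Fin.join-splitAt n p i)) (trans (cong (Fin.join n p) e) (Fin.join-splitAt n p i′))

stack-↑ˡ : ∀ {m p k} (X : Mat m k) (Y : Mat p k) i j → stack X Y (i ↑ˡ p) j ≡ X i j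
stack-↑ˡ {m} {p} X Y i j rewrite Fin.splitAt-↑ˡ m i p = refl

module _ {n p p′ : ℕ} (ρ : Fin p′ → Fin p) where

  keepTop : Fin (n + p′) → Fin (n + p)
  keepTop i = Fin.join n p (Sum.map₂ ρ (splitAt n i))

  splitAt-keepTop : ∀ i → splitAt n (keepTop i) ≡ Sum.map₂ ρ (splitAt n i)
  splitAt-keepTop i = Fin.splitAt-join n p _

  stack-keepTop : ∀ {k} (X : Mat n k) (Y : Mat p k) i j →
                  stack X (rowSub Y ρ) i j ≡ stack X Y (keepTop i) j
  stack-keepTop X Y i j rewrite splitAt-keepTop i with splitAt n i
  ... | inj₁ _ = refl
  ... | inj₂ _ = refl

  keepTop-injective : Injective _≡_ _≡_ ρ → Injective _≡_ _≡_ keepTop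
  keepTop-injective ρ-inj {i} {i′} e = splitAt-injective n (map₂-inj (trans (≡-sym (splitAt-keepTop i))
    (trans (cong (splitAt n) e) (splitAt-keepTop i′))))
    where
    map₂-inj : ∀ {x y : Fin n ⊎ Fin p′} → Sum.map₂ ρ x ≡ Sum.map₂ ρ y → x ≡ y
    map₂-inj {inj₁ _} {inj₁ _} refl = refl
    map₂-inj {inj₂ _} {inj₂ _} q    = cong inj₂ (ρ-inj (inj₂-injective q))

-- The up-matrix of a single column is empty here: the two rows of C n meeting the column dominate each other.
upMatrix≇C₁ : ∀ {n p s} → 2 ≤ n → (Y : Mat p n) (γ : Fin s → Fin n) →
              ¬ (upMatrix (colSub (stack (C n) Y) γ) ≅ C 1)
upMatrix≇C₁ {n} {p} {s} 2≤n Y γ (σ , τ , _) = upRow-undominated M x dom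
  where
  M : Mat (n + p) s
  M = colSub (stack (C n) Y) γ
  x : Fin (length (upRows M))
  x = Inverse.from σ Fin.zero
  y : Fin s
  y = Inverse.from τ Fin.zero
  y-only : ∀ z → z ≡ y
  y-only z with Inverse.to τ z in e
  ... | Fin.zero = trans (≡-sym (Inverse.strictlyInverseʳ τ z)) (cong (Inverse.from τ) e)
  column : Two (λ i → C n i (γ y))
  column = C-col-two 2≤n (γ y)
  by : ∀ r → C n r (γ y) ≡ true → r ↑ˡ p ≢ upRow M x → dominated M (upRow M x) ≡ true
  by r e r≢ = dominated⁺ M r≢ λ z _ → trans (cong (λ z → M (r ↑ˡ p) z) (y-only z))
    (trans (stack-↑ˡ (C n) Y r (γ y)) e)
  dom : dominated M (upRow M x) ≡ true
  dom with fst column ↑ˡ p Fin.≟ upRow M x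
  ... | no  f≢ = by _ (fst-true column) f≢
  ... | yes f≡ = by _ (snd-true column)
        λ s≡ → fst≢snd column (Fin.↑ˡ-injective p _ _ (trans f≡ (≡-sym s≡)))

consecutive≢ : ∀ {m k t} {M : Mat m k} (c : Cycle M t) → let open Cycle c in ∀ a → a < t → v a ≢ v (suc a)
consecutive≢ {t = t} c a a<t e with ℕ.m≤n⇒m<n∨m≡n a<t
... | inj₁ sa<t = ℕ.1+n≢n (≡-sym (v-inj a<t sa<t e))
  where open Cycle c
... | inj₂ refl with v-inj a<t (s≤s z≤n) (trans e (v-per 0))
  where open Cycle c
...   | refl with Cycle.2≤t c
...     | s≤s ()

-- From minimally unbalanced graphs to the matrix form.

module Forward {n} (G : Graph n) (df : DiamondFree G) (minimal : MinimallyUnbalanced G) where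
  open Cliques G

  tight : ∀ {t} → Odd t → TwoRegular A t → t ≡ n
  tight {t} odd T with ℕ.m≤n⇒m<n∨m≡n (Fin.injective⇒≤ (TwoRegular.col-inj T))
  ... | inj₂ t≡n = t≡n
  ... | inj₁ t<n = contradiction (proj₂ minimal t col col-inj t<n)
    (TwoRegular⇒¬Balanced odd
      (transfer {G₁ = G} {induced G col} df (induced-DiamondFree G col col-inj df) T id id (λ _ _ → refl)))
    where open TwoRegular T

  witness : Odd n × TwoRegular A n
  witness with ¬Balanced⇒TwoRegular A (proj₁ minimal)
  ... | t , odd , T with tight odd T
  ...   | refl = odd , T

  odd-n : Odd n
  odd-n = proj₁ witness

  no-smaller : NoSmaller A n
  no-smaller t t<n odd T = ℕ.<⇒≢ t<n (tight odd T)

  abstract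
    cycle : Cycle A n
    cycle = minimal⇒cycle odd-n no-smaller (proj₂ witness)

  open Cycle cycle

  0<n : 0 < n
  0<n = ℕ.≤-trans (s≤s z≤n) 2≤t

  consecutive-adj : ∀ a → a < n → adj G (v a) (v (suc a)) ≡ true
  consecutive-adj a a<n = row-adj (consecutive≢ cycle a a<n) (on a) (on⁺ a)

  -- On three vertices the cycle is a triangle, so `w 0` absorbs `v 2`, although among the columns
  -- of the cycle it contains only `v 0` and `v 1`.
  n≢3 : n ≢ 3
  n≢3 n≡3 = [ (λ e → contradiction (v-inj 2<n 0<n e) λ ()) , (λ e → contradiction (v-inj 2<n 2≤t e) λ ()) ]′
    (only-v 0 2 (row-absorbs df (consecutive≢ cycle 0 0<n) (on 0) (on⁺ 0)
      (subst (λ x → adj G (v 2) x ≡ true) (trans (cong v (≡-sym n≡3)) (v-per 0)) (consecutive-adj 2 2<n))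
      (adj-sym (consecutive-adj 1 2≤t))))
    where
    2<n : 2 < n
    2<n = subst (2 <_) (≡-sym n≡3) ℕ.≤-refl

  5≤n : 5 ≤ n
  5≤n = go odd-n 2≤t n≢3
    where
    go : ∀ {n} → Odd n → 2 ≤ n → n ≢ 3 → 5 ≤ n
    go (zero        , refl) (s≤s ()) _
    go (suc zero    , refl) _ n≢3 = contradiction refl n≢3
    go (suc (suc k) , refl) _ _   = s≤s (ℕ.*-monoʳ-≤ 2 (s≤s (s≤s z≤n)))

  cycle-rows : Fin n → Fin (length (maximalCliques G))
  cycle-rows = w ∘ toℕ

  abstract
    other-rows : ∃ λ s → s + n ≡ length (maximalCliques G) ×
                 Σ (Fin s → Fin (length (maximalCliques G))) λ h → Injective _≡_ _≡_ h ×
                 (∀ i j → h i ≢ cycle-rows j) × (∀ x → (∃ λ j → cycle-rows j ≡ x) ⊎ (∃ λ i → h i ≡ x))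
    other-rows = complement cycle-rows (below w-inj)

  p : ℕ
  p = proj₁ other-rows

  h : Fin p → Fin (length (maximalCliques G))
  h = proj₁ (proj₂ (proj₂ other-rows))

  h-injective : Injective _≡_ _≡_ h
  h-injective = proj₁ (proj₂ (proj₂ (proj₂ other-rows)))

  h≢cycle-rows : ∀ i j → h i ≢ cycle-rows j
  h≢cycle-rows = proj₁ (proj₂ (proj₂ (proj₂ (proj₂ other-rows))))

  rows-cover : ∀ x → (∃ λ j → cycle-rows j ≡ x) ⊎ (∃ λ i → h i ≡ x)
  rows-cover = proj₂ (proj₂ (proj₂ (proj₂ (proj₂ other-rows))))

  V : Fin n → Fin n
  V = v ∘ toℕ

  V-surjective : ∀ x → ∃ λ j → V j ≡ x
  V-surjective = injective⇒surjective V (below v-inj)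

  K : Mat p n
  K i j = A (h i) (V j)

  g : Fin (n + p) → Fin (length (maximalCliques G))
  g i = [ cycle-rows , h ]′ (splitAt n i)

  g-injective : Injective _≡_ _≡_ g
  g-injective {i} {i′} e = splitAt-injective n (go (splitAt n i) (splitAt n i′) e)
    where
    go : ∀ x y → [ cycle-rows , h ]′ x ≡ [ cycle-rows , h ]′ y → x ≡ y
    go (inj₁ x) (inj₁ y) e = cong inj₁ (below w-inj e)
    go (inj₁ x) (inj₂ y) e = contradiction (≡-sym e) (h≢cycle-rows y x)
    go (inj₂ x) (inj₁ y) e = contradiction e (h≢cycle-rows x y)
    go (inj₂ x) (inj₂ y) e = cong inj₂ (h-injective e)

  g-surjective : ∀ x → ∃ λ i → g i ≡ x
  g-surjective x with rows-cover x
  ... | inj₁ (j , e) = j ↑ˡ p , trans (cong [ cycle-rows , h ]′ (Fin.splitAt-↑ˡ n j p)) e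
  ... | inj₂ (i , e) = n ↑ʳ i , trans (cong [ cycle-rows , h ]′ (Fin.splitAt-↑ʳ n p i)) e

  stack≡A : ∀ i j → stack (C n) K i j ≡ A (g i) (V j)
  stack≡A i j with splitAt n i
  ... | inj₁ x = cycle-matrix cycle x j
  ... | inj₂ y = refl

  congruent : A ≅ stack (C n) K
  congruent = ≅-intro g V g-injective (below v-inj) g-surjective V-surjective stack≡A

  neighbour : ∀ x → ∃ λ y → adj G x y ≡ true
  neighbour x with V-surjective x
  ... | j , refl = v (suc (toℕ j)) , consecutive-adj (toℕ j) (Fin.toℕ<n j)

  -- Every vertex has a neighbour, so the clique has at least two vertices. All vertices lie on the
  -- cycle, so exactly two would make the row a chord.
  long-rows : ∀ r → 3 ≤ count (K r)
  long-rows r with two-in-row neighbour (v 0) (h r)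
  ... | a , b , a≢b , a∈ , b∈ with V-surjective a | V-surjective b
  ...   | i , refl | j , refl = three≤count (K r) (λ e → a≢b (cong V e)) a∈ b∈
    (no-chord (linear df) odd-n no-smaller cycle (h r) h∉w)
    where
    h∉w : ∀ a → h r ≢ w a
    h∉w a e with wrap w 0<n w-per a
    ... | j , q = h≢cycle-rows r j (trans e q)

  goodK : GoodK K
  goodK = long-rows , go
    where
    go : ∀ p′ (ρ : Fin p′ → Fin p) → Injective _≡_ _≡_ ρ → ∀ t → Odd t → t < n →
         ∀ s (γ : Fin s → Fin n) → Injective _≡_ _≡_ γ →
         ¬ (upMatrix (colSub (stack (C n) (rowSub K ρ)) γ) ≅ C t)
    -- For t = 1 there is no two-regular submatrix to contradict minimality. In every other case
    -- `C t` pulls back to one inside the clique matrix, of odd order below `n`.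
    go p′ ρ ρ-inj t (zero  , refl) t<n s γ γ-inj cong-C = upMatrix≇C₁ 2≤t (rowSub K ρ) γ cong-C
    go p′ ρ ρ-inj t odd@(suc k , refl) t<n s γ γ-inj cong-C@(σ , τ , _) = no-smaller t t<n odd
      (TwoRegular-embed (g ∘ keepTop ρ ∘ upRow M) (V ∘ γ)
        (λ e → upRow-injective M (keepTop-injective ρ ρ-inj (g-injective e))) (λ e → γ-inj (below v-inj e))
        (λ i j → trans (stack-keepTop ρ (C n) K (upRow M i) (γ j)) (stack≡A _ _))
        (TwoRegular-≅ˡ cong-C (C-TwoRegular (s≤s (s≤s z≤n)))))
      where
      M : Mat (n + p′) s
      M = colSub (stack (C n) (rowSub K ρ)) γ

-- From the matrix form back to minimally unbalanced graphs.

-- Both rows meeting a selected column must be selected, in particular the one with the same index;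
-- both columns of that row are then selected, hence so is the cyclic successor. A nonempty set of
-- columns closed under successor is everything.
C-NoSmaller : ∀ n → 2 ≤ n → NoSmaller (C n) n
C-NoSmaller (suc n) 2≤n t t<n (_ , refl) T = ℕ.<⇒≱ t<n (Fin.injective⇒≤ preimage-injective)
  where
  open TwoRegular T
  Hit : ℕ → Set
  Hit x = ∃ λ j → toℕ (col j) ≡ x
  row-hit : ∀ j → ∃ λ i → row i ≡ col j
  row-hit j with col-two j
  ... | F with C⁻ (row (fst F)) (col j) (fst-true F) | C⁻ (row (snd F)) (col j) (snd-true F)
  ... | inj₁ p | _ = fst F , Fin.toℕ-injective (≡-sym p)
  ... | inj₂ _ | inj₁ p = snd F , Fin.toℕ-injective (≡-sym p)
  ... | inj₂ (inj₁ p) | inj₂ (inj₁ q) =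
        contradiction (row-inj (Fin.toℕ-injective (ℕ.suc-injective (trans (≡-sym p) q)))) (fst≢snd F)
  ... | inj₂ (inj₂ (p , _)) | inj₂ (inj₂ (q , _)) =
        contradiction (row-inj (Fin.toℕ-injective (trans p (≡-sym q)))) (fst≢snd F)
  ... | inj₂ (inj₁ p) | inj₂ (inj₂ (_ , q)) = contradiction (trans (≡-sym p) q) λ ()
  ... | inj₂ (inj₂ (_ , q)) | inj₂ (inj₁ p) = contradiction (trans (≡-sym p) q) λ ()
  next-hit : ∀ j → Hit (suc (toℕ (col j))) ⊎ (toℕ (col j) ≡ n × Hit 0)
  next-hit j with row-hit j
  ... | i , e with row-two i
  ... | F with C⁻ (row i) (col (fst F)) (fst-true F) | C⁻ (row i) (col (snd F)) (snd-true F)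
  ... | inj₂ (inj₁ p) | _ = inj₁ (fst F , trans p (cong (suc ∘ toℕ) e))
  ... | inj₂ (inj₂ (p , q)) | _ = inj₂ (trans (cong toℕ (≡-sym e)) p , fst F , q)
  ... | inj₁ _ | inj₂ (inj₁ p) = inj₁ (snd F , trans p (cong (suc ∘ toℕ) e))
  ... | inj₁ _ | inj₂ (inj₂ (p , q)) = inj₂ (trans (cong toℕ (≡-sym e)) p , snd F , q)
  ... | inj₁ p | inj₁ q =
        contradiction (col-inj (Fin.toℕ-injective (trans p (≡-sym q)))) (fst≢snd F)
  hit-suc : ∀ {x} → suc x < suc n → Hit x → Hit (suc x)
  hit-suc (s≤s x<n) (j , refl) with next-hit j
  ... | inj₁ p       = p
  ... | inj₂ (p , _) = contradiction p (ℕ.<⇒≢ x<n)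
  hit-+ : ∀ {x} d → d + x < suc n → Hit x → Hit (d + x)
  hit-+ zero    _  p = p
  hit-+ (suc d) lt p = hit-suc lt (hit-+ d (ℕ.<-trans (ℕ.n<1+n _) lt) p)
  hit-last : Hit n
  hit-last = subst Hit n≡ (hit-+ (n ∸ x) (s≤s (ℕ.≤-reflexive n≡)) (Fin.zero , refl))
    where
    x : ℕ
    x = toℕ (col Fin.zero)
    n≡ : n ∸ x + x ≡ n
    n≡ = ℕ.m∸n+n≡m (ℕ.≤-pred (Fin.toℕ<n (col Fin.zero)))
  hit-0 : Hit 0
  hit-0 with hit-last
  ... | j , e with next-hit j
  ...   | inj₂ (_ , p)  = p
  ...   | inj₁ (i , e′) = contradiction (trans e′ (cong suc e)) (ℕ.<⇒≢ (Fin.toℕ<n (col i)))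
  hit : (x : Fin (suc n)) → Hit (toℕ x)
  hit x = subst Hit (ℕ.+-identityʳ _)
    (hit-+ (toℕ x) (subst (_< suc n) (≡-sym (ℕ.+-identityʳ _)) (Fin.toℕ<n x)) hit-0)
  preimage-injective : Injective _≡_ _≡_ (proj₁ ∘ hit)
  preimage-injective {x} {y} e =
    Fin.toℕ-injective (trans (≡-sym (proj₂ (hit x))) (trans (cong (toℕ ∘ col) e) (proj₂ (hit y))))

-- A shortest odd cycle through rows of K would, after discarding the other rows of K, make every further
-- row of C n dominated, since such a row meets the columns of the cycle at most once.
module NoShorterCycle {n p t} (K : Mat p n) (2≤n : 2 ≤ n) (lin : Linear (stack (C n) K)) (odd : Odd t)
                      (none : NoSmaller (stack (C n) K) t) (cycle : Cycle (stack (C n) K) t) where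
  open Cycle cycle

  M : Mat (n + p) n
  M = stack (C n) K

  0<t : 0 < t
  0<t = ℕ.≤-trans (s≤s z≤n) 2≤t

  OnCycle : Fin (n + p) → Set
  OnCycle x = ∃ λ (i : Fin t) → w (toℕ i) ≡ x

  OnCycle? : ∀ x → Dec (OnCycle x)
  OnCycle? x = Fin.any? λ i → w (toℕ i) Fin.≟ x

  used : List (Fin p)
  used = List.filter (λ q → OnCycle? (n ↑ʳ q)) (allFin p)

  ρ : Fin (length used) → Fin p
  ρ = List.lookup used

  ρ-injective : Injective _≡_ _≡_ ρ
  ρ-injective = lookup-injective (Unique.filter⁺ (λ q → OnCycle? (n ↑ʳ q)) (Unique.allFin⁺ p))

  ρ-used : ∀ i → OnCycle (n ↑ʳ ρ i)
  ρ-used i = proj₂ (∈-filter⁻ (λ q → OnCycle? (n ↑ʳ q)) {xs = allFin p} (∈-lookup i))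

  e : Fin (n + length used) → Fin (n + p)
  e = keepTop ρ

  e-injective : Injective _≡_ _≡_ e
  e-injective = keepTop-injective ρ ρ-injective

  e-hits : ∀ i → ∃ λ u → e u ≡ w (toℕ i)
  e-hits i with splitAt n (w (toℕ i)) in s
  ... | inj₁ x = x ↑ˡ length used , splitAt-injective n (trans (splitAt-keepTop ρ _)
        (trans (cong (Sum.map₂ ρ) (Fin.splitAt-↑ˡ n x _)) (≡-sym s)))
  ... | inj₂ q = n ↑ʳ index q∈ , splitAt-injective n (trans (splitAt-keepTop ρ _)
        (trans (cong (Sum.map₂ ρ) (Fin.splitAt-↑ʳ n _ (index q∈)))
          (trans (cong inj₂ (≡-sym (lookup-index q∈))) (≡-sym s))))
    where
    q∈ : q ∈ used
    q∈ = ∈-filter⁺ (λ q → OnCycle? (n ↑ʳ q)) (∈-allFin q) (i , ≡-sym (Fin.splitAt⁻¹-↑ʳ s))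

  u : Fin t → Fin (n + length used)
  u i = proj₁ (e-hits i)

  γ : Fin t → Fin n
  γ = v ∘ toℕ

  N : Mat (n + length used) t
  N = colSub (stack (C n) (rowSub K ρ)) γ

  N≡M : ∀ i j → N i j ≡ M (e i) (γ j)
  N≡M i j = stack-keepTop ρ (C n) K i (γ j)

  N-u : ∀ i j → N (u i) j ≡ M (w (toℕ i)) (γ j)
  N-u i j = trans (N≡M (u i) j) (cong (λ x → M x (γ j)) (proj₂ (e-hits i)))

  -- A row above `u i` shares with it two consecutive columns of the cycle, so linearity makes the
  -- two rows equal.
  u-undominated : ∀ i → dominated N (u i) ≢ true
  u-undominated i dom with dominated⁻ N dom | wrap v 0<t v-per (suc (toℕ i))
  ... | x , x≢u , ≤ᵣ | j , next = x≢u (e-injective (trans (≡-sym same) (≡-sym (proj₂ (e-hits i)))))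
    where
    on-next : M (w (toℕ i)) (γ j) ≡ true
    on-next = subst (λ y → M (w (toℕ i)) y ≡ true) next (on⁺ (toℕ i))
    same : w (toℕ i) ≡ e x
    same = lin {a = γ i} {γ j} (λ q → consecutive≢ cycle (toℕ i) (Fin.toℕ<n i) (trans q (≡-sym next)))
      (on (toℕ i)) on-next
      (trans (≡-sym (N≡M x i)) (≤ᵣ i (trans (N-u i i) (on (toℕ i)))))
      (trans (≡-sym (N≡M x j)) (≤ᵣ j (trans (N-u i j) on-next)))

  -- The kept rows of `K` are all on the cycle, so `x` is a row of `C n`; with both its 1's on cycle
  -- columns it would be a chord. If it meets the single column `j`, it lies below `u j`, and if it
  -- meets none, it lies below any other row.
  off-cycle⇒dominated : ∀ x → ¬ OnCycle (e x) → dominated N x ≡ true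
  off-cycle⇒dominated x off = go (splitAt n x) refl
    where
    u≢ : ∀ i → u i ≢ x
    u≢ i q = off (i , trans (≡-sym (proj₂ (e-hits i))) (cong e q))
    not-used : ∀ q → splitAt n x ≢ inj₂ q
    not-used q s = off (subst OnCycle (splitAt-injective n (trans (Fin.splitAt-↑ʳ n p (ρ q))
      (≡-sym (trans (splitAt-keepTop ρ x) (cong (Sum.map₂ ρ) s))))) (ρ-used q))
    e-x∉w : ∀ a → e x ≢ w a
    e-x∉w a q with wrap w 0<t w-per a
    ... | i , r = off (i , ≡-sym (trans q r))
    top : ∀ y → splitAt n x ≡ inj₁ y → ∀ j → N x j ≡ C n y (γ j)
    top y s j = cong [ (λ a → C n a (γ j)) , (λ b → rowSub K ρ b (γ j)) ]′ s
    one-column : ∀ y → splitAt n x ≡ inj₁ y → ∀ j j′ → N x j ≡ true → N x j′ ≡ true → j ≡ j′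
    one-column y s j j′ xj xj′ with j Fin.≟ j′
    ... | yes j≡j′ = j≡j′
    ... | no  j≢j′ with mate (C-row-two 2≤n y) (trans (≡-sym (top y s j)) xj)
    ...   | b , _ , _ , y-only = contradiction two (no-chord lin odd none cycle (e x) e-x∉w)
      where
      γj′≡b : γ j′ ≡ b
      γj′≡b with y-only (γ j′) (trans (≡-sym (top y s j′)) xj′)
      ... | inj₁ q = contradiction (≡-sym (below v-inj q)) j≢j′
      ... | inj₂ q = q
      two : Two (λ i → M (e x) (γ i))
      two = record
        { fst = j ; snd = j′ ; fst≢snd = j≢j′
        ; fst-true = trans (≡-sym (N≡M x j)) xj ; snd-true = trans (≡-sym (N≡M x j′)) xj′
        ; only = λ i q → Sum.map (below v-inj) (λ r → below v-inj (trans r (≡-sym γj′≡b)))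
                   (y-only (γ i) (trans (≡-sym (top y s i)) (trans (N≡M x i) q))) }
    go : ∀ z → splitAt n x ≡ z → dominated N x ≡ true
    go (inj₂ q) s = contradiction s (not-used q)
    go (inj₁ y) s with Fin.any? (λ j → N x j Bool.≟ true)
    ... | no  empty    = dominated⁺ N (u≢ (fromℕ< 0<t)) λ j q → contradiction (j , q) empty
    ... | yes (j , xj) = dominated⁺ N (u≢ j) λ j′ xj′ →
            subst (λ i → N (u j) i ≡ true) (one-column y s j j′ xj xj′) (trans (N-u j j) (on (toℕ j)))

  u-injective : Injective _≡_ _≡_ u
  u-injective {i} {j} q =
    below w-inj (trans (≡-sym (proj₂ (e-hits i))) (trans (cong e q) (proj₂ (e-hits j))))

  u-up : ∀ i → ∃ λ x → upRow N x ≡ u i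
  u-up i = undominated-upRow N (u i) (u-undominated i)

  up-surjective : ∀ x → ∃ λ i → proj₁ (u-up i) ≡ x
  up-surjective x with OnCycle? (e (upRow N x))
  ... | no off      = contradiction (off-cycle⇒dominated (upRow N x) off) (upRow-undominated N x)
  ... | yes (i , q) = i , upRow-injective N (trans (proj₂ (u-up i)) (e-injective (trans (proj₂ (e-hits i)) q)))

  upMatrix≅C : upMatrix N ≅ C t
  upMatrix≅C = ≅-intro (proj₁ ∘ u-up) id
    (λ {i} {j} q → u-injective (trans (≡-sym (proj₂ (u-up i))) (trans (cong (upRow N) q) (proj₂ (u-up j)))))
    id up-surjective (λ y → y , refl)
    (λ i j → trans (cycle-matrix cycle i j)
      (trans (≡-sym (N-u i j)) (cong (λ x → N x j) (≡-sym (proj₂ (u-up i))))))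

-- Strong induction on the order supplies the minimality that the cycle decomposition and the chord
-- argument require.
GoodK⇒NoSmaller : ∀ {n p} (K : Mat p n) → 2 ≤ n → Linear (stack (C n) K) → GoodK K → NoSmaller (stack (C n) K) n
GoodK⇒NoSmaller {n} K 2≤n lin (_ , noC) = <-rec _ go
  where
  go : ∀ t → (∀ {t′} → t′ < t → t′ < n → Odd t′ → ¬ TwoRegular (stack (C n) K) t′) →
       t < n → Odd t → ¬ TwoRegular (stack (C n) K) t
  go t rec t<n odd T = noC _ ρ ρ-injective t odd t<n t γ (below (Cycle.v-inj cycle)) upMatrix≅C
    where
    none : NoSmaller (stack (C n) K) t
    none t′ t′<t = rec t′<t (ℕ.<-trans t′<t t<n)
    cycle : Cycle (stack (C n) K) t
    cycle = minimal⇒cycle odd none T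
    open NoShorterCycle K 2≤n lin odd none cycle using (ρ; ρ-injective; γ; upMatrix≅C)

-- An odd two-regular submatrix of an induced subgraph on `k` vertices has order at most `k`, and it
-- transfers to `G`, where orders below `n` are excluded.
minimallyUnbalanced : ∀ {n} {G : Graph n} → DiamondFree G → Odd n → TwoRegular (cliqueMatrix G) n →
                      NoSmaller (cliqueMatrix G) n → MinimallyUnbalanced G
minimallyUnbalanced {n} {G} df odd T none = TwoRegular⇒¬Balanced odd T , proper
  where
  proper : ∀ k (f : Fin k → Fin n) → Injective _≡_ _≡_ f → k < n → BalancedGraph (induced G f)
  proper k f f-inj k<n t odd-t r r-inj c c-inj (r₂ , c₂) =
    none t (ℕ.≤-<-trans (Fin.injective⇒≤ c-inj) k<n) odd-t
      (transfer {G₁ = induced G f} {G} (induced-DiamondFree G f f-inj df) df S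
        (f ∘ c) (λ q → c-inj (f-inj q)) λ _ _ → refl)
    where
    S : TwoRegular (cliqueMatrix (induced G f)) t
    S = record
      { row = r ; col = c ; row-inj = r-inj ; col-inj = c-inj
      ; row-two = λ i → count≡2⇒Two _ (r₂ i) ; col-two = λ j → count≡2⇒Two _ (c₂ j) }

theorem1 : (n : ℕ) (G : Graph n) → DiamondFree G →
    (MinimallyUnbalanced G ⇔
    (5 ≤ n × Odd n ×
    (cliqueMatrix G ≅ C n ⊎
    Σ ℕ λ p → Σ (Mat p n) λ K → GoodK K × (cliqueMatrix G ≅ stack (C n) K))))
theorem1 n G df = mk⇔ forward backward
  where
  forward : MinimallyUnbalanced G → 5 ≤ n × Odd n ×
            (cliqueMatrix G ≅ C n ⊎ Σ ℕ λ p → Σ (Mat p n) λ K → GoodK K × (cliqueMatrix G ≅ stack (C n) K))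
  -- `p` may be 0: `K` has no rows when every maximal clique is a row of the cycle.
  forward minimal = 5≤n , odd-n , inj₂ (p , K , goodK , congruent)
    where open Forward G df minimal
  backward : 5 ≤ n × Odd n ×
             (cliqueMatrix G ≅ C n ⊎ Σ ℕ λ p → Σ (Mat p n) λ K → GoodK K × (cliqueMatrix G ≅ stack (C n) K)) →
             MinimallyUnbalanced G
  backward (5≤n , odd , inj₁ A≅C) = minimallyUnbalanced {G = G} df odd
    (TwoRegular-≅ˡ {N = C n} A≅C (C-TwoRegular 2≤n))
    λ t t<n odd-t T → C-NoSmaller n 2≤n t t<n odd-t (TwoRegular-≅ʳ {N = C n} A≅C T)
    where
    2≤n : 2 ≤ n
    2≤n = ℕ.≤-trans (s≤s (s≤s z≤n)) 5≤n
  backward (5≤n , odd , inj₂ (p , K , good , A≅S)) = minimallyUnbalanced {G = G} df odd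
    (TwoRegular-≅ˡ {N = stack (C n) K} A≅S (TwoRegular-embed (_↑ˡ p) id (Fin.↑ˡ-injective p _ _) id
      (λ i j → ≡-sym (stack-↑ˡ (C n) K i j)) (C-TwoRegular 2≤n)))
    λ t t<n odd-t T → GoodK⇒NoSmaller K 2≤n (Linear-≅ {N = stack (C n) K} A≅S (Cliques.linear G df)) good
                        t t<n odd-t (TwoRegular-≅ʳ {N = stack (C n) K} A≅S T)
    where
    2≤n : 2 ≤ n
    2≤n = ℕ.≤-trans (s≤s (s≤s z≤n)) 5≤n
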